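{- Let $\mathcal{G}$ be a class of graphs closed under taking subgraphs such that every graph in $\mathcal{G}$ is $H$-minor-free for some fixed graph $H$. Then $\mathrm{pcol}_\star(\mathcal{G})=p(\mathcal{G})$.
   Context: All graphs are finite and simple. A $t$-island in $G$ is a non-empty $S\subseteq V(G)$ such that every vertex of $S$ has fewer than $t$ neighbors in $V(G)\setminus S$. $t$-percolation: starting with a set $A_0\subseteq V(G)$ of active vertices, repeatedly make active any inactive vertex with at least $t$ active neighbors, until no such vertex exists; $A_0$ $t$-percolates if at the end all vertices are active. For $\varepsilon>0$, $G$ is $\varepsilon$-resistant to $t$-percolation if no set of at most $\varepsilon|V(G)|$ vertices of $G$ $t$-percolates. The percolation threshold $p(\mathcal{G})$ is the minimum integer $t$ such that for some $\varepsilon>0$ all graphs in $\mathcal{G}$ with at least one vertex are $\varepsilon$-resistant to $t$-percolation ($\infty$ if none). The pervasive clustered coloring number $\mathrm{pcol}_\star(\mathcal{G})$ is the minimum integer $t$ such that for some $\varepsilon>0$ every $G\in\mathcal{G}$ contains at least $\varepsilon|V(G)|$ pairwise disjoint $t$-islands ($\infty$ if none). -}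

module Defs where

open import Data.Nat using (ℕ; zero; suc; _≤_; _<_; _≤ᵇ_)
open import Data.Bool using (Bool; true; false; _∧_; _∨_; not)
open import Data.Fin using (Fin)
open import Data.Fin.Subset using (Subset; _∈_; ∣_∣; ⊤; Nonempty)
open import Data.Vec using (lookup; tabulate)
open import Data.Integer using (+_)
open import Data.Rational using (ℚ; _/_; _*_; 0ℚ) renaming (_≤_ to _≤ℚ_; _<_ to _<ℚ_)
open import Data.Product using (Σ; ∃; ∃-syntax; _×_; _,_)
open import Data.Maybe using (Maybe; just; nothing)
open import Function.Definitions using (Injective)
open import Relation.Binary.PropositionalEquality using (_≡_; _≢_)
open import Relation.Nullary using (¬_)
open import Data.Empty using (⊥)

record Graph : Set where
  field
    n      : ℕ
    adj    : Fin n → Fin n → Bool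
    sym    : ∀ u v → adj u v ≡ adj v u
    irrefl : ∀ v → adj v v ≡ false
open Graph public

GraphClass : Set₁
GraphClass = Graph → Set

_⊆G_ : Graph → Graph → Set
H ⊆G G = Σ (Fin (n H) → Fin (n G)) λ f →
  Injective _≡_ _≡_ f × (∀ u v → adj H u v ≡ true → adj G (f u) (f v) ≡ true)

ClosedUnderSubgraphs : GraphClass → Set
ClosedUnderSubgraphs 𝒢 = ∀ G H → 𝒢 G → H ⊆G G → 𝒢 H

data WalkIn (G : Graph) (S : Subset (n G)) : Fin (n G) → Fin (n G) → Set where
  here : ∀ {x} → x ∈ S → WalkIn G S x x
  step : ∀ {x z y} → x ∈ S → adj G x z ≡ true → WalkIn G S z y → WalkIn G S x y

ConnectedIn : (G : Graph) → Subset (n G) → Set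
ConnectedIn G S = ∀ x y → x ∈ S → y ∈ S → WalkIn G S x y

Disjoint : ∀ {m} → Subset m → Subset m → Set
Disjoint A B = ∀ x → x ∈ A → x ∈ B → ⊥

_≼_ : Graph → Graph → Set
H ≼ G = Σ (Fin (n H) → Subset (n G)) λ B →
    (∀ a → Nonempty (B a))
  × (∀ a b → a ≢ b → Disjoint (B a) (B b))
  × (∀ a → ConnectedIn G (B a))
  × (∀ a b → adj H a b ≡ true →
       ∃[ x ] ∃[ y ] (x ∈ B a × y ∈ B b × adj G x y ≡ true))

MinorFree : Graph → Graph → Set
MinorFree H G = ¬ (H ≼ G)

ℕ→ℚ : ℕ → ℚ
ℕ→ℚ k = + k / 1

nbrsIn : (G : Graph) → Subset (n G) → Fin (n G) → ℕ
nbrsIn G A v = ∣ tabulate (λ u → adj G v u ∧ lookup A u) ∣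

nbrsOut : (G : Graph) → Subset (n G) → Fin (n G) → ℕ
nbrsOut G S v = ∣ tabulate (λ u → adj G v u ∧ not (lookup S u)) ∣

IsIsland : (t : ℕ) (G : Graph) → Subset (n G) → Set
IsIsland t G S = Nonempty S × (∀ v → v ∈ S → nbrsOut G S v < t)

percStep : (t : ℕ) (G : Graph) → Subset (n G) → Subset (n G)
percStep t G A = tabulate (λ v → lookup A v ∨ (t ≤ᵇ nbrsIn G A v))

iter : ∀ {A : Set} → (A → A) → ℕ → A → A
iter f zero    a = a
iter f (suc k) a = f (iter f k a)

-- A₀ t-percolates: after finitely many rounds every vertex is active
-- (the process is monotone, so this is exactly "the final active set is V(G)").
Percolates : (t : ℕ) (G : Graph) → Subset (n G) → Set
Percolates t G A₀ = ∃[ k ] iter (percStep t G) k A₀ ≡ ⊤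

Resistant : ℚ → ℕ → Graph → Set
Resistant ε t G = ∀ (A : Subset (n G)) →
  ℕ→ℚ ∣ A ∣ ≤ℚ ε * ℕ→ℚ (n G) → ¬ Percolates t G A

PercProp : GraphClass → ℕ → Set
PercProp 𝒢 t = ∃[ ε ] (0ℚ <ℚ ε × (∀ G → 𝒢 G → 0 < n G → Resistant ε t G))

HasManyIslands : ℚ → ℕ → Graph → Set
HasManyIslands ε t G = ∃[ k ] Σ (Fin k → Subset (n G)) λ S →
    ε * ℕ→ℚ (n G) ≤ℚ ℕ→ℚ k
  × (∀ i → IsIsland t G (S i))
  × (∀ i j → i ≢ j → Disjoint (S i) (S j))

PcolProp : GraphClass → ℕ → Set
PcolProp 𝒢 t = ∃[ ε ] (0ℚ <ℚ ε × (∀ G → 𝒢 G → HasManyIslands ε t G))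

-- m is the minimum t satisfying P, with nothing = ∞ (no such t)
IsMinimum : (ℕ → Set) → Maybe ℕ → Set
IsMinimum P (just t) = P t × (∀ s → s < t → ¬ P s)
IsMinimum P nothing  = ∀ t → ¬ P t

PercThreshold : GraphClass → Maybe ℕ → Set
PercThreshold 𝒢 = IsMinimum (PercProp 𝒢)

PcolNumber : GraphClass → Maybe ℕ → Set
PcolNumber 𝒢 = IsMinimum (PcolProp 𝒢)

{-# OPTIONS --safe #-}
module Submission where

-- The two properties are equivalent for each fixed t.  A percolating set meets every
-- t-island, which gives one direction.  Conversely, H-minor-free graphs are hyperfinite:
-- deleting a small proportion X of the vertices leaves mutually non-adjacent parts of
-- bounded size.  Percolate from X; what stays inactive in a part is, if non-empty, a
-- t-island, and X together with all inactive vertices percolates, so by resistance the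
-- inactive vertices, hence the islands, are linearly many.
--
-- Hyperfiniteness follows from halving separators as in Plotkin, Rao and Smith.  Grow a
-- clique minor with small bags next to a shrinking remainder R.  A bag without neighbours
-- in R is set aside; otherwise, either short paths in R join neighbours of all the bags,
-- giving a new bag, or two distant vertices have disjoint balls, and the smaller ball
-- cannot keep expanding, so that it can be cut off along a sparse layer.

open import Defs renaming (sym to adj-sym)
open import Data.Bool using (Bool; true; false; _∧_; _∨_; not)
open import Data.Bool.Properties using (T-≡; ∨-zeroʳ) renaming (_≟_ to _≟ᵇ_)
open import Data.Fin using (Fin; zero; suc; punchIn; punchOut; _≟_)
open import Data.Fin.Properties using (any?; punchIn-injective; punchIn-punchOut; suc-injective)
open import Data.Fin.Subset hiding (⊥)
import Data.Fin.Subset as Subset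
open import Data.Fin.Subset.Properties
open import Data.Integer using (+≤+) renaming (+_ to pos)
import Data.Integer as ℤ
import Data.Integer.Properties as ℤ
open import Data.List using (List; []; _∷_; map; _++_; length; filter)
import Data.List as List
import Data.List.Membership.Propositional as List
open import Data.List.Membership.Propositional.Properties using (∈-lookup)
open import Data.List.Relation.Unary.All as All using (All; []; _∷_)
import Data.List.Relation.Unary.All.Properties as All
open import Data.List.Relation.Unary.AllPairs as AllPairs using (AllPairs; []; _∷_)
import Data.List.Relation.Unary.AllPairs.Properties as AllPairs
open import Data.List.Relation.Unary.Any as Any using (Any; here; there)
import Data.List.Relation.Unary.Any.Properties as Any
open import Data.Maybe using (Maybe; just; nothing)
open import Data.Nat hiding (_≟_)
import Data.Nat as ℕ
open import Data.Nat.DivMod using (m≡m%n+[m/n]*n; m/n*n≤m; m%n<n)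
open import Data.Nat.Properties hiding (_≟_; suc-injective)
open import Data.Nat.Tactic.RingSolver using (solve-∀)
open import Data.Product using (Σ; ∃-syntax; _×_; _,_; proj₁; proj₂)
open import Data.Rational using (mkℚ; toℚᵘ; 0ℚ) renaming (_/_ to _/ℚ_; _≤_ to _≤ℚ_; _<_ to _<ℚ_; _*_ to _*ℚ_)
import Data.Rational as ℚ
import Data.Rational.Properties as ℚ
open import Data.Rational.Unnormalised using (mkℚᵘ)
import Data.Rational.Unnormalised as ℚᵘ
import Data.Rational.Unnormalised.Properties as ℚᵘ
open import Data.Sum using (_⊎_; inj₁; inj₂; [_,_]′; map₁)
open import Data.Vec using ([]; _∷_; tabulate; lookup; here; there)
open import Data.Vec.Properties using (lookup∘tabulate; lookup⇒[]=; []=⇒lookup)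
open import Function using (_∘_; _⇔_; mk⇔; Equivalence)
open import Level using (Level)
open import Relation.Binary using (Rel; Symmetric)
open import Relation.Binary.PropositionalEquality hiding ([_])
open import Relation.Nullary
open import Relation.Nullary.Decidable using (dec-true; decidable-stable)
open import Relation.Unary using (Pred; Decidable)

open Equivalence using (to; from)

private variable
  a ℓ : Level
  m : ℕ

-- Cardinalities of finite subsets and their unions.

∈tabulate⁺ : ∀ (f : Fin m → Bool) {x} → f x ≡ true → x ∈ tabulate f
∈tabulate⁺ f {x} fx = lookup⇒[]= x _ (trans (lookup∘tabulate f x) fx)

∈tabulate⁻ : ∀ (f : Fin m → Bool) {x} → x ∈ tabulate f → f x ≡ true
∈tabulate⁻ f {x} x∈ = trans (sym (lookup∘tabulate f x)) ([]=⇒lookup x∈)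

tabulate-⊆ : ∀ {f g : Fin m → Bool} → (∀ x → f x ≡ true → g x ≡ true) → tabulate f ⊆ tabulate g
tabulate-⊆ {f = f} {g} f⇒g x∈ = ∈tabulate⁺ g (f⇒g _ (∈tabulate⁻ f x∈))

comprehension : {P : Pred (Fin m) ℓ} → Decidable P → Subset m
comprehension P? = tabulate (does ∘ P?)

module _ {P : Pred (Fin m) ℓ} (P? : Decidable P) where

  comprehension⁺ : ∀ {x} → P x → x ∈ comprehension P?
  comprehension⁺ {x} px = ∈tabulate⁺ (does ∘ P?) (dec-true (P? x) px)

  comprehension⁻ : ∀ {x} → x ∈ comprehension P? → P x
  comprehension⁻ {x} x∈ with P? x | ∈tabulate⁻ (does ∘ P?) x∈
  ... | yes px | _ = px

x∈p─q⇒x∉q : ∀ (p q : Subset m) {x} → x ∈ p ─ q → x ∉ q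
x∈p─q⇒x∉q (_ ∷ p) (outside ∷ q) {zero}  _ ()
x∈p─q⇒x∉q (_ ∷ p) (inside  ∷ q) {zero}  ()
x∈p─q⇒x∉q (_ ∷ p) (_       ∷ q) {suc x} x∈ x∈q = x∈p─q⇒x∉q p q (drop-there x∈) (drop-there x∈q)

∣p∪q∣≤∣p∣+∣q∣ : ∀ (p q : Subset m) → ∣ p ∪ q ∣ ≤ ∣ p ∣ + ∣ q ∣
∣p∪q∣≤∣p∣+∣q∣ []            []            = z≤n
∣p∪q∣≤∣p∣+∣q∣ (outside ∷ p) (outside ∷ q) = ∣p∪q∣≤∣p∣+∣q∣ p q
∣p∪q∣≤∣p∣+∣q∣ (outside ∷ p) (inside  ∷ q) =
  ≤-trans (s≤s (∣p∪q∣≤∣p∣+∣q∣ p q)) (≤-reflexive (sym (+-suc ∣ p ∣ ∣ q ∣)))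
∣p∪q∣≤∣p∣+∣q∣ (inside  ∷ p) (outside ∷ q) = s≤s (∣p∪q∣≤∣p∣+∣q∣ p q)
∣p∪q∣≤∣p∣+∣q∣ (inside  ∷ p) (inside  ∷ q) =
  s≤s (≤-trans (∣p∪q∣≤∣p∣+∣q∣ p q) (+-monoʳ-≤ ∣ p ∣ (n≤1+n ∣ q ∣)))

drop-Disjoint : ∀ {s t} {p q : Subset m} → Disjoint (s ∷ p) (t ∷ q) → Disjoint p q
drop-Disjoint d x x∈p x∈q = d (suc x) (there x∈p) (there x∈q)

∣p∣+∣q∣≤∣p∪q∣ : ∀ (p q : Subset m) → Disjoint p q → ∣ p ∣ + ∣ q ∣ ≤ ∣ p ∪ q ∣
∣p∣+∣q∣≤∣p∪q∣ []            []            d = z≤n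
∣p∣+∣q∣≤∣p∪q∣ (outside ∷ p) (outside ∷ q) d = ∣p∣+∣q∣≤∣p∪q∣ p q (drop-Disjoint d)
∣p∣+∣q∣≤∣p∪q∣ (outside ∷ p) (inside  ∷ q) d =
  ≤-trans (≤-reflexive (+-suc ∣ p ∣ ∣ q ∣)) (s≤s (∣p∣+∣q∣≤∣p∪q∣ p q (drop-Disjoint d)))
∣p∣+∣q∣≤∣p∪q∣ (inside  ∷ p) (outside ∷ q) d = s≤s (∣p∣+∣q∣≤∣p∪q∣ p q (drop-Disjoint d))
∣p∣+∣q∣≤∣p∪q∣ (inside  ∷ p) (inside  ∷ q) d with () ← d zero here here

∪-lub : {p q r : Subset m} → p ⊆ r → q ⊆ r → p ∪ q ⊆ r
∪-lub {p = p} {q} p⊆r q⊆r x∈ with x∈p∪q⁻ p q x∈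
... | inj₁ x∈p = p⊆r x∈p
... | inj₂ x∈q = q⊆r x∈q

∣p∣+∣q∣≤∣r∣ : {p q r : Subset m} → Disjoint p q → p ⊆ r → q ⊆ r → ∣ p ∣ + ∣ q ∣ ≤ ∣ r ∣
∣p∣+∣q∣≤∣r∣ {p = p} {q} d p⊆r q⊆r = ≤-trans (∣p∣+∣q∣≤∣p∪q∣ p q d) (p⊆q⇒∣p∣≤∣q∣ (∪-lub p⊆r q⊆r))

0<∣p∣⇒Nonempty : {p : Subset m} → 0 < ∣ p ∣ → Nonempty p
0<∣p∣⇒Nonempty {m} {p} 0<p with nonempty? p
... | yes ne = ne
... | no  em with refl ← Empty-unique em = contradiction 0<p (<-irrefl (sym (∣⊥∣≡0 m)))

⊤-⊇ : {p : Subset m} → (∀ x → x ∈ p) → p ≡ ⊤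
⊤-⊇ all = ⊆-antisym ⊆⊤ (λ _ → all _)

⋃ᶠ : ∀ {k} → (Fin k → Subset m) → Subset m
⋃ᶠ {k = zero}  B = Subset.⊥
⋃ᶠ {k = suc k} B = B zero ∪ ⋃ᶠ (B ∘ suc)

∈⋃ᶠ⁺ : ∀ {k} (B : Fin k → Subset m) i {x} → x ∈ B i → x ∈ ⋃ᶠ B
∈⋃ᶠ⁺ B zero    x∈ = p⊆p∪q _ x∈
∈⋃ᶠ⁺ B (suc i) x∈ = q⊆p∪q (B zero) _ (∈⋃ᶠ⁺ (B ∘ suc) i x∈)

∣⋃ᶠ∣≤ : ∀ {k s} (B : Fin k → Subset m) → (∀ i → ∣ B i ∣ ≤ s) → ∣ ⋃ᶠ B ∣ ≤ k * s
∣⋃ᶠ∣≤ {m} {k = zero}  B small = ≤-reflexive (∣⊥∣≡0 m)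
∣⋃ᶠ∣≤ {k = suc k} B small =
  ≤-trans (∣p∪q∣≤∣p∣+∣q∣ (B zero) _) (+-mono-≤ (small zero) (∣⋃ᶠ∣≤ (B ∘ suc) (small ∘ suc)))

-- Touching vertex sets, walks and connected sets.

module _ (G : Graph) where

  private V = Fin (n G)

  Adj : V → V → Set
  Adj x y = adj G x y ≡ true

  Adj-sym : ∀ {x y} → Adj x y → Adj y x
  Adj-sym {x} {y} xy = trans (adj-sym G y x) xy

  Adj? : ∀ x y → Dec (Adj x y)
  Adj? x y = adj G x y ≟ᵇ true

  Touch : Subset (n G) → Subset (n G) → Set
  Touch p q = ∃[ x ] ∃[ y ] (x ∈ p × y ∈ q × Adj x y)

  Touch-sym : ∀ {p q} → Touch p q → Touch q p
  Touch-sym (x , y , x∈ , y∈ , xy) = y , x , y∈ , x∈ , Adj-sym xy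

  Touch? : ∀ p q → Dec (Touch p q)
  Touch? p q = any? λ x → any? λ y → x ∈? p ×-dec y ∈? q ×-dec Adj? x y

  walk-mono : ∀ {p q} → p ⊆ q → ∀ {x y} → WalkIn G p x y → WalkIn G q x y
  walk-mono p⊆q (here x∈)      = here (p⊆q x∈)
  walk-mono p⊆q (step x∈ xz w) = step (p⊆q x∈) xz (walk-mono p⊆q w)

  walk-trans : ∀ {p x y z} → WalkIn G p x y → WalkIn G p y z → WalkIn G p x z
  walk-trans (here _)       w′ = w′
  walk-trans (step x∈ xz w) w′ = step x∈ xz (walk-trans w w′)

  ConnectedIn-⁅⁆ : ∀ v → ConnectedIn G ⁅ v ⁆
  ConnectedIn-⁅⁆ v x y x∈ y∈ with refl ← x∈⁅y⁆⇒x≡y v x∈ | refl ← x∈⁅y⁆⇒x≡y v y∈ = here x∈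

  ConnectedIn-∪-adj : ∀ {p q x y} → ConnectedIn G p → ConnectedIn G q →
                      x ∈ p → y ∈ q → Adj x y → ConnectedIn G (p ∪ q)
  ConnectedIn-∪-adj {p} {q} {x} {y} cp cq x∈p y∈q xy a b a∈ b∈
    with x∈p∪q⁻ p q a∈ | x∈p∪q⁻ p q b∈
  ... | inj₁ a∈p | inj₁ b∈p = walk-mono (p⊆p∪q q) (cp a b a∈p b∈p)
  ... | inj₂ a∈q | inj₂ b∈q = walk-mono (q⊆p∪q p q) (cq a b a∈q b∈q)
  ... | inj₁ a∈p | inj₂ b∈q =
    walk-trans (walk-mono (p⊆p∪q q) (cp a x a∈p x∈p))
      (step (p⊆p∪q q x∈p) xy (walk-mono (q⊆p∪q p q) (cq y b y∈q b∈q)))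
  ... | inj₂ a∈q | inj₁ b∈p =
    walk-trans (walk-mono (q⊆p∪q p q) (cq a y a∈q y∈q))
      (step (q⊆p∪q p q y∈q) (Adj-sym xy) (walk-mono (p⊆p∪q q) (cp x b x∈p b∈p)))

  ConnectedIn-∪-meet : ∀ {p q z} → ConnectedIn G p → ConnectedIn G q →
                       z ∈ p → z ∈ q → ConnectedIn G (p ∪ q)
  ConnectedIn-∪-meet {p} {q} {z} cp cq z∈p z∈q a b a∈ b∈ =
    walk-trans (to-z a∈) (from-z b∈)
    where
    to-z : ∀ {a} → a ∈ p ∪ q → WalkIn G (p ∪ q) a z
    to-z {a} a∈ with x∈p∪q⁻ p q a∈
    ... | inj₁ a∈p = walk-mono (p⊆p∪q q) (cp a z a∈p z∈p)
    ... | inj₂ a∈q = walk-mono (q⊆p∪q p q) (cq a z a∈q z∈q)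
    from-z : ∀ {b} → b ∈ p ∪ q → WalkIn G (p ∪ q) z b
    from-z {b} b∈ with x∈p∪q⁻ p q b∈
    ... | inj₁ b∈p = walk-mono (p⊆p∪q q) (cp z b z∈p b∈p)
    ... | inj₂ b∈q = walk-mono (q⊆p∪q p q) (cq z b z∈q b∈q)

  -- Breadth-first balls inside `R`: expansion, sparse layers and short connections.

  module _ (R : Subset (n G)) where

    inLayer? : ∀ D → Decidable (λ v → v ∈ R × v ∉ D × ∃[ u ] (u ∈ D × Adj u v))
    inLayer? D v = v ∈? R ×-dec ¬? (v ∈? D) ×-dec any? (λ u → u ∈? D ×-dec Adj? u v)

    layer : Subset (n G) → Subset (n G)
    layer D = comprehension (inLayer? D)

    layer⊆ : ∀ D → layer D ⊆ R
    layer⊆ D = proj₁ ∘ comprehension⁻ (inLayer? D)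

    layer-disjoint : ∀ D → Disjoint D (layer D)
    layer-disjoint D x x∈D x∈L = proj₁ (proj₂ (comprehension⁻ (inLayer? D) x∈L)) x∈D

    -- For `v` in `R`, this is the ball of radius `j` in the subgraph induced by `R`.
    ball : V → ℕ → Subset (n G)
    ball v zero    = ⁅ v ⁆
    ball v (suc j) = ball v j ∪ layer (ball v j)

    center∈ball : ∀ v j → v ∈ ball v j
    center∈ball v zero    = x∈⁅x⁆ v
    center∈ball v (suc j) = p⊆p∪q _ (center∈ball v j)

    ball⊆ : ∀ {v} → v ∈ R → ∀ j → ball v j ⊆ R
    ball⊆ {v} v∈R zero x∈ with refl ← x∈⁅y⁆⇒x≡y v x∈ = v∈R
    ball⊆ v∈R (suc j) = ∪-lub (ball⊆ v∈R j) (layer⊆ _)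

    ball-mono : ∀ v {i j} → i ≤ j → ball v i ⊆ ball v j
    ball-mono v {j = zero}  z≤n x∈ = x∈
    ball-mono v {i} {suc j} i≤j x∈ with m≤n⇒m<n∨m≡n i≤j
    ... | inj₁ (s≤s i≤j′) = p⊆p∪q _ (ball-mono v i≤j′ x∈)
    ... | inj₂ refl       = x∈

    -- A small connected set stands in for a short path: the unions formed later need connectedness
    -- and size, not an order of the vertices.
    record Link (v w : V) (s : ℕ) : Set where
      constructor mkLink
      field
        {link}     : Subset (n G)
        link⊆      : link ⊆ R
        link-size  : ∣ link ∣ ≤ s
        source∈    : v ∈ link
        target∈    : w ∈ link
        link-conn  : ConnectedIn G link

    -- A vertex of the newest layer has a neighbour in the previous ball, so each unit of radius
    -- adds at most one vertex to the connecting set.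
    ball-link : ∀ {v} → v ∈ R → ∀ j {x} → x ∈ ball v j → Link v x (suc j)
    ball-link {v} v∈R zero {x} x∈ with refl ← x∈⁅y⁆⇒x≡y v x∈ =
      mkLink (ball⊆ v∈R zero) (≤-reflexive (∣⁅x⁆∣≡1 v)) x∈ x∈ (ConnectedIn-⁅⁆ v)
    ball-link {v} v∈R (suc j) {x} x∈ with x∈p∪q⁻ (ball v j) _ x∈
    ... | inj₁ x∈B = let mkLink ⊆R size v∈ x∈Q conn = ball-link v∈R j x∈B
                     in mkLink ⊆R (m≤n⇒m≤1+n size) v∈ x∈Q conn
    ... | inj₂ x∈L with comprehension⁻ (inLayer? (ball v j)) x∈L
    ...   | x∈R , _ , u , u∈B , ux with ball-link v∈R j u∈B
    ...     | mkLink {Q} ⊆R size v∈ u∈Q conn = mkLink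
      (∪-lub (λ y∈ → subst (_∈ R) (sym (x∈⁅y⁆⇒x≡y x y∈)) x∈R) ⊆R)
      (≤-trans (∣p∪q∣≤∣p∣+∣q∣ ⁅ x ⁆ Q) (+-mono-≤ (≤-reflexive (∣⁅x⁆∣≡1 x)) size))
      (q⊆p∪q ⁅ x ⁆ Q v∈) (p⊆p∪q Q (x∈⁅x⁆ x))
      (ConnectedIn-∪-adj (ConnectedIn-⁅⁆ x) conn (x∈⁅x⁆ x) u∈Q (Adj-sym ux))

    -- Deleting the layer that separates `piece` from the rest of `R` costs at most a proportion
    -- `1 / l` of `piece`.
    record Cut (l c : ℕ) : Set where
      constructor mkCut
      field
        piece          : Subset (n G)
        piece⊆         : piece ⊆ R
        piece-nonempty : Nonempty piece
        piece-size     : ∣ piece ∣ ≤ c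
        piece-sparse   : l * ∣ layer piece ∣ ≤ ∣ piece ∣

    sparseOrExpanding : ∀ l v N → (∃[ j ] (j < N × l * ∣ layer (ball v j) ∣ ≤ ∣ ball v j ∣))
                                ⊎ (∀ j → j < N → ∣ ball v j ∣ ≤ l * ∣ layer (ball v j) ∣)
    sparseOrExpanding l v zero    = inj₂ λ _ ()
    sparseOrExpanding l v (suc N) with sparseOrExpanding l v N
    ... | inj₁ (j , j<N , sparse) = inj₁ (j , m≤n⇒m≤1+n j<N , sparse)
    ... | inj₂ exp with ≤-total (l * ∣ layer (ball v N) ∣) ∣ ball v N ∣
    ...   | inj₁ sparse = inj₁ (N , ≤-refl , sparse)
    ...   | inj₂ dense  = inj₂ λ j j<1+N → [ exp j , (λ { refl → dense }) ]′ (m≤n⇒m<n∨m≡n (s≤s⁻¹ j<1+N))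

    -- Each layer added has at least `1 / l` times as many vertices as its ball, and the balls from
    -- radius `a` on contain `ball v a`; the gains add up.
    ball-growth : ∀ l v a i → (∀ j → j < a + i → ∣ ball v j ∣ ≤ l * ∣ layer (ball v j) ∣) →
                  (l + i) * ∣ ball v a ∣ ≤ l * ∣ ball v (a + i) ∣
    ball-growth l v a zero exp =
      ≤-reflexive (cong₂ (λ x y → x * ∣ ball v y ∣) (+-identityʳ l) (sym (+-identityʳ a)))
    ball-growth l v a (suc i) exp = begin
      (l + suc i) * ∣ ball v a ∣               ≡⟨ cong (_* ∣ ball v a ∣) (trans (+-suc l i) (+-comm 1 (l + i))) ⟩
      (l + i + 1) * ∣ ball v a ∣               ≡⟨ *-distribʳ-+ ∣ ball v a ∣ (l + i) 1 ⟩
      (l + i) * ∣ ball v a ∣ + 1 * ∣ ball v a ∣ ≡⟨ cong ((l + i) * ∣ ball v a ∣ +_) (*-identityˡ _) ⟩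
      (l + i) * ∣ ball v a ∣ + ∣ ball v a ∣     ≤⟨ +-mono-≤ (ball-growth l v a i (λ j j< → exp j (≤-trans j< (+-monoʳ-≤ a (n≤1+n i)))))
                                                          (p⊆q⇒∣p∣≤∣q∣ (ball-mono v (m≤m+n a i))) ⟩
      l * ∣ ball v (a + i) ∣ + ∣ ball v (a + i) ∣ ≤⟨ +-monoʳ-≤ (l * ∣ ball v (a + i) ∣) (exp (a + i) (≤-reflexive (sym (+-suc a i)))) ⟩
      l * ∣ ball v (a + i) ∣ + l * ∣ layer (ball v (a + i)) ∣ ≡⟨ *-distribˡ-+ l _ _ ⟨
      l * (∣ ball v (a + i) ∣ + ∣ layer (ball v (a + i)) ∣) ≤⟨ *-monoʳ-≤ l (∣p∣+∣q∣≤∣p∪q∣ _ _ (layer-disjoint (ball v (a + i)))) ⟩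
      l * ∣ ball v (suc (a + i)) ∣             ≡⟨ cong (λ x → l * ∣ ball v x ∣) (+-suc a i) ⟨
      l * ∣ ball v (a + suc i) ∣               ∎
      where open ≤-Reasoning

    -- Every `l` expanding steps double the ball, by `ball-growth` with `i = l`.
    ball-doubling : ∀ l .{{_ : NonZero l}} v β → (∀ j → j < β * l → ∣ ball v j ∣ ≤ l * ∣ layer (ball v j) ∣) →
                    2 ^ β ≤ ∣ ball v (β * l) ∣
    ball-doubling l v zero    exp = ≤-reflexive (sym (∣⁅x⁆∣≡1 v))
    ball-doubling l v (suc β) exp = begin
      2 * 2 ^ β            ≤⟨ *-monoʳ-≤ 2 (ball-doubling l v β (λ j j< → exp j (≤-trans j< (m≤n+m (β * l) l)))) ⟩
      2 * ∣ ball v (β * l) ∣ ≤⟨ *-cancelˡ-≤ l doubled ⟩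
      ∣ ball v (β * l + l) ∣ ≡⟨ cong (λ x → ∣ ball v x ∣) (+-comm (β * l) l) ⟩
      ∣ ball v (l + β * l) ∣ ∎
      where
      open ≤-Reasoning
      doubled : l * (2 * ∣ ball v (β * l) ∣) ≤ l * ∣ ball v (β * l + l) ∣
      doubled = begin
        l * (2 * ∣ ball v (β * l) ∣) ≡⟨ *-assoc l 2 _ ⟨
        l * 2 * ∣ ball v (β * l) ∣   ≡⟨ cong (_* ∣ ball v (β * l) ∣) (trans (*-comm l 2) (cong (l +_) (+-identityʳ l))) ⟩
        (l + l) * ∣ ball v (β * l) ∣ ≤⟨ ball-growth l v (β * l) l (λ j j< → exp j (≤-trans j< (≤-reflexive (+-comm (β * l) l)))) ⟩
        l * ∣ ball v (β * l + l) ∣   ∎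

    -- If no layer before radius `suc b * l` were sparse, doubling would produce `2 ^ suc b`
    -- vertices, more than the ball has.
    smallBall⇒Cut : ∀ l .{{_ : NonZero l}} b {v} → v ∈ R →
                    ∣ ball v (suc b * l) ∣ ≤ 2 ^ b → Cut l (2 ^ b)
    smallBall⇒Cut l b {v} v∈R small with sparseOrExpanding l v (suc b * l)
    ... | inj₁ (j , j< , sparse) = mkCut (ball v j) (ball⊆ v∈R j) (v , center∈ball v j)
            (≤-trans (p⊆q⇒∣p∣≤∣q∣ (ball-mono v (<⇒≤ j<))) small) sparse
    ... | inj₂ exp = contradiction (≤-trans (ball-doubling l v (suc b) exp) small)
                       (<⇒≱ (^-monoʳ-< 2 ≤-refl (n<1+n b)))

    -- Balls that meet give a link through a common vertex. Disjoint balls share the at most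
    -- `2 ^ suc b` vertices of `R`, so one of them has at most `2 ^ b` and contains a ball with a
    -- sparse layer.
    cutOrLink : ∀ l .{{_ : NonZero l}} b {v w} → v ∈ R → w ∈ R → ∣ R ∣ ≤ 2 ^ suc b →
                Cut l (2 ^ b) ⊎ Link v w (2 * suc (suc b * l))
    cutOrLink l b {v} {w} v∈R w∈R ∣R∣≤ with nonempty? (ball v (suc b * l) ∩ ball w (suc b * l))
    ... | yes (z , z∈) = inj₂ (mkLink (∪-lub ⊆₁ ⊆₂)
            (≤-trans (∣p∪q∣≤∣p∣+∣q∣ P Q) (≤-trans (+-mono-≤ size₁ size₂) (≤-reflexive (cong (suc ρ +_) (sym (+-identityʳ _))))))
            (p⊆p∪q Q v∈P) (q⊆p∪q P Q w∈Q) (ConnectedIn-∪-meet conn₁ conn₂ z∈P z∈Q))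
      where
      ρ = suc b * l
      z∈₁₂ = x∈p∩q⁻ (ball v ρ) (ball w ρ) z∈
      open Link (ball-link v∈R ρ (proj₁ z∈₁₂)) renaming (link to P; link⊆ to ⊆₁; link-size to size₁; source∈ to v∈P; target∈ to z∈P; link-conn to conn₁)
      open Link (ball-link w∈R ρ (proj₂ z∈₁₂)) renaming (link to Q; link⊆ to ⊆₂; link-size to size₂; source∈ to w∈Q; target∈ to z∈Q; link-conn to conn₂)
    ... | no disjoint with ∣ ball v (suc b * l) ∣ ≤? 2 ^ b | ∣ ball w (suc b * l) ∣ ≤? 2 ^ b
    ...   | yes small | _         = inj₁ (smallBall⇒Cut l b v∈R small)
    ...   | no _      | yes small = inj₁ (smallBall⇒Cut l b w∈R small)
    ...   | no big₁   | no big₂   = contradiction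
      (≤-trans (∣p∣+∣q∣≤∣r∣ (λ x x∈₁ x∈₂ → disjoint (x , x∈p∩q⁺ (x∈₁ , x∈₂))) (ball⊆ v∈R ρ) (ball⊆ w∈R ρ)) ∣R∣≤)
      (<⇒≱ (subst (_< ∣ ball v ρ ∣ + ∣ ball w ρ ∣) (cong (2 ^ b +_) (sym (+-identityʳ _)))
        (+-mono-< (≰⇒> big₁) (≰⇒> big₂))))
      where ρ = suc b * l

    -- This becomes a new bag, the `w i` being chosen neighbours of the old bags; cycles are
    -- allowed.
    record Tree {k} (w : Fin k → V) (s : ℕ) : Set where
      constructor mkTree
      field
        tree          : Subset (n G)
        tree⊆         : tree ⊆ R
        tree-size     : ∣ tree ∣ ≤ s
        tree-nonempty : Nonempty tree
        tree-conn     : ConnectedIn G tree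
        tree-hits     : ∀ i → w i ∈ tree

    -- All links start at the common root `v`, so their union is connected. The root is kept in the
    -- result for the induction, and it accounts for the `suc` in the size.
    cutOrTree : ∀ l .{{_ : NonZero l}} b {v} → v ∈ R → ∣ R ∣ ≤ 2 ^ suc b →
                ∀ {k} (w : Fin k → V) → (∀ i → w i ∈ R) →
                Cut l (2 ^ b) ⊎ Σ (Tree w (suc (k * (2 * suc (suc b * l))))) λ T → v ∈ Tree.tree T
    cutOrTree l b {v} v∈R ∣R∣≤ {zero} w w∈R =
      inj₂ (mkTree ⁅ v ⁆ (ball⊆ v∈R zero) (≤-reflexive (∣⁅x⁆∣≡1 v)) (v , x∈⁅x⁆ v) (ConnectedIn-⁅⁆ v) (λ ()) , x∈⁅x⁆ v)
    cutOrTree l b {v} v∈R ∣R∣≤ {suc k} w w∈R with cutOrTree l b v∈R ∣R∣≤ (w ∘ suc) (w∈R ∘ suc)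
    ... | inj₁ cut = inj₁ cut
    ... | inj₂ (mkTree T ⊆₁ size₁ ne conn₁ hits , v∈T) with cutOrLink l b v∈R (w∈R zero) ∣R∣≤
    ...   | inj₁ cut = inj₁ cut
    ...   | inj₂ (mkLink {Q} ⊆₂ size₂ v∈Q w∈Q conn₂) = inj₂
      (mkTree (T ∪ Q) (∪-lub ⊆₁ ⊆₂)
        (≤-trans (∣p∪q∣≤∣p∣+∣q∣ T Q) (≤-trans (+-mono-≤ size₁ size₂) (≤-reflexive (cong suc (+-comm (k * s) s)))))
        (v , p⊆p∪q Q v∈T) (ConnectedIn-∪-meet conn₁ conn₂ v∈T v∈Q)
        (λ { zero → q⊆p∪q T Q w∈Q ; (suc i) → p⊆p∪q Q (hits i) })
      , p⊆p∪q Q v∈T)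
      where s = 2 * suc (suc b * l)

-- Clique minors with bags of bounded size.

module _ (G : Graph) where

  record Model (k s : ℕ) : Set where
    field
      bag          : Fin k → Subset (n G)
      bag-nonempty : ∀ i → Nonempty (bag i)
      bag-disjoint : ∀ i j → i ≢ j → Disjoint (bag i) (bag j)
      bag-conn     : ∀ i → ConnectedIn G (bag i)
      bag-touch    : ∀ i j → i ≢ j → Touch G (bag i) (bag j)
      bag-size     : ∀ i → ∣ bag i ∣ ≤ s
  open Model

  -- All pairs of bags touch, so any assignment of the vertices of `H` to the bags works; an edge
  -- joins distinct bags because `H` has no loops.
  Model⇒≼ : ∀ {s} (H : Graph) → Model (n H) s → H ≼ G
  Model⇒≼ H M = bag M , bag-nonempty M , bag-disjoint M , bag-conn M , λ a b ab →
    bag-touch M a b λ { refl → contradiction (trans (sym ab) (irrefl H a)) λ () }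

  emptyModel : ∀ {s} → Model 0 s
  emptyModel = record
    { bag = λ () ; bag-nonempty = λ () ; bag-disjoint = λ () ; bag-conn = λ ()
    ; bag-touch = λ () ; bag-size = λ () }

  removeBag : ∀ {k s} → Model (suc k) s → Fin (suc k) → Model k s
  removeBag M i = record
    { bag          = bag M ∘ punchIn i
    ; bag-nonempty = bag-nonempty M ∘ punchIn i
    ; bag-disjoint = λ a b a≢b → bag-disjoint M _ _ (a≢b ∘ punchIn-injective i a b)
    ; bag-conn     = bag-conn M ∘ punchIn i
    ; bag-touch    = λ a b a≢b → bag-touch M _ _ (a≢b ∘ punchIn-injective i a b)
    ; bag-size     = bag-size M ∘ punchIn i
    }

  addBag : ∀ {k s} (M : Model k s) (T : Subset (n G)) → Nonempty T → ConnectedIn G T → ∣ T ∣ ≤ s →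
           (∀ i → Disjoint (bag M i) T) → (∀ i → Touch G (bag M i) T) → Model (suc k) s
  addBag {k} {s} M T ne conn size disj touch = record
    { bag          = B
    ; bag-nonempty = λ { zero → ne ; (suc i) → bag-nonempty M i }
    ; bag-disjoint = disj′
    ; bag-conn     = λ { zero → conn ; (suc i) → bag-conn M i }
    ; bag-touch    = touch′
    ; bag-size     = λ { zero → size ; (suc i) → bag-size M i }
    }
    where
    B : Fin (suc k) → Subset (n G)
    B zero    = T
    B (suc i) = bag M i
    disj′ : ∀ i j → i ≢ j → Disjoint (B i) (B j)
    disj′ zero    zero    0≢0 = contradiction refl 0≢0
    disj′ zero    (suc j) _   = λ x x∈T x∈j → disj j x x∈j x∈T
    disj′ (suc i) zero    _   = disj i
    disj′ (suc i) (suc j) i≢j = bag-disjoint M i j (i≢j ∘ cong suc)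
    touch′ : ∀ i j → i ≢ j → Touch G (B i) (B j)
    touch′ zero    zero    0≢0 = contradiction refl 0≢0
    touch′ zero    (suc j) _   = Touch-sym G (touch j)
    touch′ (suc i) zero    _   = touch i
    touch′ (suc i) (suc j) i≢j = bag-touch M i j (i≢j ∘ cong suc)

  -- Mutually non-adjacent parts and decompositions.

  Apart : Subset (n G) → Subset (n G) → Set
  Apart p q = Disjoint p q × ¬ Touch G p q

  Apart-⊥ : ∀ {p} → Apart p Subset.⊥
  Apart-⊥ = (λ x _ x∈⊥ → ∉⊥ x∈⊥) , λ (_ , _ , _ , y∈⊥ , _) → ∉⊥ y∈⊥

  Apart-⊆ : ∀ {p p′ q q′} → p′ ⊆ p → q′ ⊆ q → Apart p q → Apart p′ q′
  Apart-⊆ p′⊆p q′⊆q (disj , ¬touch) =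
    (λ x x∈p x∈q → disj x (p′⊆p x∈p) (q′⊆q x∈q)) ,
    λ (x , y , x∈ , y∈ , xy) → ¬touch (x , y , p′⊆p x∈ , q′⊆q y∈ , xy)

  Apart-∪ˡ : ∀ {p q r} → Apart p r → Apart q r → Apart (p ∪ q) r
  Apart-∪ˡ {p} {q} (dp , tp) (dq , tq) =
    (λ x x∈ x∈r → [ (λ x∈p → dp x x∈p x∈r) , (λ x∈q → dq x x∈q x∈r) ]′ (x∈p∪q⁻ p q x∈)) ,
    λ (x , y , x∈ , y∈ , xy) →
      [ (λ x∈p → tp (x , y , x∈p , y∈ , xy)) , (λ x∈q → tq (x , y , x∈q , y∈ , xy)) ]′ (x∈p∪q⁻ p q x∈)

  -- The parts need not avoid `X`: it is enough that they cover what `X` misses.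
  record Decomposition (K : ℕ) (U X : Subset (n G)) : Set where
    constructor mkDecomposition
    field
      parts        : List (Subset (n G))
      parts-small  : All (λ P → ∣ P ∣ ≤ K) parts
      parts-apart  : AllPairs Apart parts
      parts-within : All (_⊆ U) parts
      parts-cover  : ∀ {x} → x ∈ U → x ∈ X ⊎ Any (x ∈_) parts

  -- The halving separator.

  module Separator (H : Graph) (H⋠G : MinorFree H G)
                   (U : Subset (n G)) (b l : ℕ) .{{_ : NonZero l}} where

    h = n H

    -- The size given by `cutOrTree` for `h` targets, used as a uniform bound for all bags.
    bagBound : ℕ
    bagBound = suc (h * (2 * suc (suc b * l)))

    -- S collects what has been cut off, R is what remains, and Z consists of the deleted
    -- layers, whose size is charged to the balls they bound.
    record State (S R : Subset (n G)) (k : ℕ) : Set where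
      field
        model      : Model k bagBound
        Z          : Subset (n G)
        k≤h        : k ≤ h
        S⊆U        : S ⊆ U
        R⊆U        : R ⊆ U
        bag⊆U      : ∀ i → bag model i ⊆ U
        S-R-apart  : Apart S R
        bag-R      : ∀ i → Disjoint (bag model i) R
        cover      : ∀ {x} → x ∈ U → x ∈ S ⊎ x ∈ R ⊎ x ∈ Z ⊎ ∃[ i ] x ∈ bag model i
        Z-sparse   : l * ∣ Z ∣ ≤ ∣ S ∣
    open State

    -- Two charges: `∣ U ∣` pays for the deleted layers, `l * (h * bagBound)` for at most `h`
    -- deleted bags.
    Separated : Set
    Separated = ∃[ X ] (Decomposition (2 ^ b) U X × l * ∣ X ∣ ≤ ∣ U ∣ + l * (h * bagBound))

    -- S₂ is the last ball: while ∣ R ∣ > 2 ^ b, at most 2 ^ b vertices were in S₁, so stopping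
    -- before the two are merged keeps all three parts small.
    finish : ∀ {S₁ S₂ R k} → Apart S₁ S₂ → ∣ S₁ ∣ ≤ 2 ^ b → ∣ S₂ ∣ ≤ 2 ^ b → ∣ R ∣ ≤ 2 ^ b →
             State (S₁ ∪ S₂) R k → Separated
    finish {S₁} {S₂} {R} {k} apart small₁ small₂ smallR st =
      Z st ∪ ⋃ᶠ (bag (model st)) ,
      mkDecomposition (S₁ ∷ S₂ ∷ R ∷ [])
        (small₁ ∷ small₂ ∷ smallR ∷ [])
        ((apart ∷ Apart-⊆ (p⊆p∪q S₂) ⊆-refl (S-R-apart st) ∷ []) ∷
         (Apart-⊆ (q⊆p∪q S₁ S₂) ⊆-refl (S-R-apart st) ∷ []) ∷ [] ∷ [])
        ((λ x∈ → S⊆U st (p⊆p∪q S₂ x∈)) ∷ (λ x∈ → S⊆U st (q⊆p∪q S₁ S₂ x∈)) ∷ R⊆U st ∷ [])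
        covered ,
      cost
      where
      covered : ∀ {x} → x ∈ U → x ∈ Z st ∪ ⋃ᶠ (bag (model st)) ⊎ Any (x ∈_) (S₁ ∷ S₂ ∷ R ∷ [])
      covered x∈U with cover st x∈U
      ... | inj₁ x∈S = inj₂ ([ here , (λ x∈S₂ → there (here x∈S₂)) ]′ (x∈p∪q⁻ S₁ S₂ x∈S))
      ... | inj₂ (inj₁ x∈R) = inj₂ (there (there (here x∈R)))
      ... | inj₂ (inj₂ (inj₁ x∈Z)) = inj₁ (p⊆p∪q _ x∈Z)
      ... | inj₂ (inj₂ (inj₂ (i , x∈i))) = inj₁ (q⊆p∪q (Z st) _ (∈⋃ᶠ⁺ (bag (model st)) i x∈i))
      open ≤-Reasoning
      cost : l * ∣ Z st ∪ ⋃ᶠ (bag (model st)) ∣ ≤ ∣ U ∣ + l * (h * bagBound)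
      cost = begin
        l * ∣ Z st ∪ ⋃ᶠ (bag (model st)) ∣             ≤⟨ *-monoʳ-≤ l (∣p∪q∣≤∣p∣+∣q∣ (Z st) _) ⟩
        l * (∣ Z st ∣ + ∣ ⋃ᶠ (bag (model st)) ∣)        ≡⟨ *-distribˡ-+ l ∣ Z st ∣ _ ⟩
        l * ∣ Z st ∣ + l * ∣ ⋃ᶠ (bag (model st)) ∣      ≤⟨ +-mono-≤ (≤-trans (Z-sparse st) (p⊆q⇒∣p∣≤∣q∣ (S⊆U st)))
                                                           (*-monoʳ-≤ l (≤-trans (∣⋃ᶠ∣≤ _ (bag-size (model st))) (*-monoˡ-≤ bagBound (k≤h st)))) ⟩
        ∣ U ∣ + l * (h * bagBound)                      ∎

    -- Having no neighbour in `R`, the bag can join `S` and leave it apart from `R`. Nothing is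
    -- deleted, and a larger `S` only helps `Z-sparse`.
    dropBag : ∀ {S R k} (st : State S R (suc k)) i → ¬ Touch G (bag (model st) i) R →
              State (S ∪ bag (model st) i) R k
    dropBag {S} {R} {k} st i ¬touch = record
      { model     = removeBag (model st) i
      ; Z         = Z st
      ; k≤h       = ≤-trans (n≤1+n k) (k≤h st)
      ; S⊆U       = ∪-lub (S⊆U st) (bag⊆U st i)
      ; R⊆U       = R⊆U st
      ; bag⊆U     = bag⊆U st ∘ punchIn i
      ; S-R-apart = Apart-∪ˡ (S-R-apart st) (bag-R st i , ¬touch)
      ; bag-R     = bag-R st ∘ punchIn i
      ; cover     = covered
      ; Z-sparse  = ≤-trans (Z-sparse st) (∣p∣≤∣p∪q∣ S _)
      }
      where
      B = bag (model st)
      covered : ∀ {x} → x ∈ U → x ∈ S ∪ B i ⊎ x ∈ R ⊎ x ∈ Z st ⊎ ∃[ j ] x ∈ B (punchIn i j)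
      covered x∈U with cover st x∈U
      ... | inj₁ x∈S = inj₁ (p⊆p∪q _ x∈S)
      ... | inj₂ (inj₁ x∈R) = inj₂ (inj₁ x∈R)
      ... | inj₂ (inj₂ (inj₁ x∈Z)) = inj₂ (inj₂ (inj₁ x∈Z))
      ... | inj₂ (inj₂ (inj₂ (j , x∈j))) with i ≟ j
      ...   | yes refl = inj₁ (q⊆p∪q S _ x∈j)
      ...   | no  i≢j  = inj₂ (inj₂ (inj₂ (punchOut i≢j , subst (λ a → _ ∈ B a) (sym (punchIn-punchOut i≢j)) x∈j)))

    -- The number of bags falls while `R` stays fixed; the surviving bags supply the neighbours that
    -- a tree has to reach.
    prune : ∀ {R} k {S} → State S R k →
            ∃[ S′ ] ∃[ k′ ] Σ (State S′ R k′) λ st → ∀ i → Touch G (bag (model st) i) R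
    prune zero st = _ , _ , st , λ ()
    prune {R} (suc k) st with any? (λ i → ¬? (Touch? G (bag (model st) i) R))
    ... | yes (i , ¬touch) = prune k (dropBag st i ¬touch)
    ... | no ¬∃ = _ , _ , st , λ i → decidable-stable (Touch? G (bag (model st) i) R) (λ ¬touch → ¬∃ (i , ¬touch))

    -- The layer holds every neighbour of the piece in the rest of `R`, so deleting it keeps `S ∪ D`
    -- apart from what remains. Its cost is charged to the piece, which is disjoint from `S`, so no
    -- vertex is charged twice.
    cutState : ∀ {S R k} (st : State S R k) (cut : Cut G R l (2 ^ b)) → let D = Cut.piece cut in
               State (S ∪ D) (R ─ (D ∪ layer G R D)) k
    cutState {S} {R} {k} st (mkCut D D⊆R ne size sparse) = record
      { model     = model st
      ; Z         = Z st ∪ W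
      ; k≤h       = k≤h st
      ; S⊆U       = ∪-lub (S⊆U st) (λ x∈ → R⊆U st (D⊆R x∈))
      ; R⊆U       = λ x∈ → R⊆U st (R′⊆R x∈)
      ; bag⊆U     = bag⊆U st
      ; S-R-apart = Apart-∪ˡ (Apart-⊆ ⊆-refl R′⊆R (S-R-apart st)) D-R′-apart
      ; bag-R     = λ i x x∈i x∈R′ → bag-R st i x x∈i (R′⊆R x∈R′)
      ; cover     = covered
      ; Z-sparse  = sparse′
      }
      where
      W = layer G R D
      R′ = R ─ (D ∪ W)
      R′⊆R : R′ ⊆ R
      R′⊆R = p─q⊆p R (D ∪ W)
      D-R′-apart : Apart D R′
      D-R′-apart = (λ x x∈D x∈R′ → x∈p─q⇒x∉q R (D ∪ W) x∈R′ (p⊆p∪q W x∈D)) ,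
        λ (x , y , x∈D , y∈R′ , xy) → x∈p─q⇒x∉q R (D ∪ W) y∈R′
          (q⊆p∪q D W (comprehension⁺ (inLayer? G R D)
            (R′⊆R y∈R′ , (λ y∈D → x∈p─q⇒x∉q R (D ∪ W) y∈R′ (p⊆p∪q W y∈D)) , x , x∈D , xy)))
      covered : ∀ {x} → x ∈ U → x ∈ S ∪ D ⊎ x ∈ R′ ⊎ x ∈ Z st ∪ W ⊎ ∃[ i ] x ∈ bag (model st) i
      covered {x} x∈U with cover st x∈U
      ... | inj₁ x∈S = inj₁ (p⊆p∪q _ x∈S)
      ... | inj₂ (inj₂ (inj₁ x∈Z)) = inj₂ (inj₂ (inj₁ (p⊆p∪q _ x∈Z)))
      ... | inj₂ (inj₂ (inj₂ x∈B)) = inj₂ (inj₂ (inj₂ x∈B))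
      ... | inj₂ (inj₁ x∈R) with x ∈? D | x ∈? W
      ...   | yes x∈D | _       = inj₁ (q⊆p∪q S _ x∈D)
      ...   | no _    | yes x∈W = inj₂ (inj₂ (inj₁ (q⊆p∪q (Z st) _ x∈W)))
      ...   | no x∉D  | no x∉W  = inj₂ (inj₁ (x∈p∧x∉q⇒x∈p─q x∈R ([ x∉D , x∉W ]′ ∘ x∈p∪q⁻ D W)))
      open ≤-Reasoning
      sparse′ : l * ∣ Z st ∪ W ∣ ≤ ∣ S ∪ D ∣
      sparse′ = begin
        l * ∣ Z st ∪ W ∣             ≤⟨ *-monoʳ-≤ l (∣p∪q∣≤∣p∣+∣q∣ (Z st) W) ⟩
        l * (∣ Z st ∣ + ∣ W ∣)        ≡⟨ *-distribˡ-+ l ∣ Z st ∣ ∣ W ∣ ⟩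
        l * ∣ Z st ∣ + l * ∣ W ∣      ≤⟨ +-mono-≤ (Z-sparse st) sparse ⟩
        ∣ S ∣ + ∣ D ∣                ≤⟨ ∣p∣+∣q∣≤∣p∪q∣ S D (λ x x∈S x∈D → proj₁ (S-R-apart st) x x∈S (D⊆R x∈D)) ⟩
        ∣ S ∪ D ∣                    ∎

    -- The tree lies in `R`, hence misses the old bags, and it contains a neighbour `w i` of each of
    -- them: the clique model gains a bag.
    treeState : ∀ {S R k} (st : State S R k) → k < h → ∀ {w : Fin k → Fin (n G)} →
                (∀ i → ∃[ x ] (x ∈ bag (model st) i × Adj G x (w i))) →
                (T : Tree G R w bagBound) → State S (R ─ Tree.tree T) (suc k)
    treeState {S} {R} {k} st k<h near (mkTree T T⊆R size ne conn hits) = record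
      { model     = addBag (model st) T ne conn size
                      (λ i x x∈i x∈T → bag-R st i x x∈i (T⊆R x∈T))
                      (λ i → let x , x∈i , xw = near i in x , _ , x∈i , hits i , xw)
      ; Z         = Z st
      ; k≤h       = k<h
      ; S⊆U       = S⊆U st
      ; R⊆U       = λ x∈ → R⊆U st (p─q⊆p R T x∈)
      ; bag⊆U     = λ { zero → λ x∈ → R⊆U st (T⊆R x∈) ; (suc i) → bag⊆U st i }
      ; S-R-apart = Apart-⊆ ⊆-refl (p─q⊆p R T) (S-R-apart st)
      ; bag-R     = λ { zero    x x∈T x∈R′ → x∈p─q⇒x∉q R T x∈R′ x∈T
                      ; (suc i) x x∈i x∈R′ → bag-R st i x x∈i (p─q⊆p R T x∈R′) }
      ; cover     = covered
      ; Z-sparse  = Z-sparse st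
      }
      where
      covered : ∀ {x} → x ∈ U → x ∈ S ⊎ x ∈ R ─ T ⊎ x ∈ Z st ⊎ ∃[ i ] x ∈ _
      covered {x} x∈U with cover st x∈U
      ... | inj₁ x∈S = inj₁ x∈S
      ... | inj₂ (inj₂ (inj₁ x∈Z)) = inj₂ (inj₂ (inj₁ x∈Z))
      ... | inj₂ (inj₂ (inj₂ (i , x∈i))) = inj₂ (inj₂ (inj₂ (suc i , x∈i)))
      ... | inj₂ (inj₁ x∈R) with x ∈? T
      ...   | yes x∈T = inj₂ (inj₂ (inj₂ (zero , x∈T)))
      ...   | no x∉T  = inj₂ (inj₁ (x∈p∧x∉q⇒x∈p─q x∈R x∉T))

    module _ (∣U∣≤ : ∣ U ∣ ≤ 2 ^ suc b) where

      -- `S` and `R` are disjoint inside `U`, so they cannot both exceed half of the bound on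
      -- `∣ U ∣`.
      S-small : ∀ {S R k} → State S R k → 2 ^ b < ∣ R ∣ → ∣ S ∣ ≤ 2 ^ b
      S-small {S} {R} st big = +-cancelʳ-≤ (2 ^ b) ∣ S ∣ (2 ^ b) (begin
        ∣ S ∣ + 2 ^ b    ≤⟨ +-monoʳ-≤ ∣ S ∣ (<⇒≤ big) ⟩
        ∣ S ∣ + ∣ R ∣    ≤⟨ ∣p∣+∣q∣≤∣r∣ (proj₁ (S-R-apart st)) (S⊆U st) (R⊆U st) ⟩
        ∣ U ∣            ≤⟨ ∣U∣≤ ⟩
        2 ^ suc b        ≡⟨ cong (2 ^ b +_) (+-identityʳ (2 ^ b)) ⟩
        2 ^ b + 2 ^ b    ∎)
        where open ≤-Reasoning

      -- The fuel `r` bounds `∣ R ∣`: a cut and a tree each take at least one vertex out of `R`.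
      loop : ∀ r {S R k} → State S R k → 2 ^ b < ∣ R ∣ → ∣ R ∣ ≤ r → Separated
      loop zero    st big R≤r = contradiction (≤-trans big R≤r) λ ()
      loop (suc r) {R = R} {k} st₀ big R≤r with prune k st₀
      ... | S , k , st , touch with k ℕ.≟ h
      -- A complete minor on `h` vertices contains `H`.
      ...   | yes refl = contradiction (Model⇒≼ H (model st)) H⋠G
      ...   | no k≢h with cutOrTree G R l b (proj₂ (0<∣p∣⇒Nonempty (≤-trans (s≤s z≤n) big)))
                            (≤-trans (p⊆q⇒∣p∣≤∣q∣ (R⊆U st)) ∣U∣≤)
                            (λ i → proj₁ (proj₂ (touch i)))
                            (λ i → let _ , _ , _ , y∈R , _ = touch i in y∈R)
      ...     | inj₁ cut@(mkCut D D⊆R (d , d∈D) size _) = next (∣ R′ ∣ ≤? 2 ^ b)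
        where
        R′ = R ─ (D ∪ layer G R D)
        next : Dec (∣ R′ ∣ ≤ 2 ^ b) → Separated
        next (yes small) = finish (Apart-⊆ ⊆-refl D⊆R (S-R-apart st)) (S-small st big) size small
                             (cutState st cut)
        next (no ¬small) = loop r (cutState st cut) (≰⇒> ¬small)
          (s≤s⁻¹ (≤-trans (p∩q≢∅⇒∣p─q∣<∣p∣ R _ (d , x∈p∩q⁺ (D⊆R d∈D , p⊆p∪q _ d∈D))) R≤r))
      ...     | inj₂ (mkTree T T⊆R size (v , v∈T) conn hits , _) = next (∣ R ─ T ∣ ≤? 2 ^ b)
        where
        k<h = ≤∧≢⇒< (k≤h st) k≢h
        st′ = treeState st k<h (λ i → let x , _ , x∈ , _ , xy = touch i in x , x∈ , xy)
                (mkTree T T⊆R (≤-trans size (s≤s (*-monoˡ-≤ (2 * suc (suc b * l)) (<⇒≤ k<h)))) (v , v∈T) conn hits)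
        next : Dec (∣ R ─ T ∣ ≤ 2 ^ b) → Separated
        -- No ball was cut off in this round, so the second part is empty.
        next (yes small) = finish Apart-⊥ (S-small st big) (≤-trans (≤-reflexive (∣⊥∣≡0 (n G))) z≤n) small
                             (subst (λ S → State S _ _) (sym (∪-identityʳ S)) st′)
        next (no ¬small) = loop r st′ (≰⇒> ¬small)
          (s≤s⁻¹ (≤-trans (p∩q≢∅⇒∣p─q∣<∣p∣ R T (v , x∈p∩q⁺ (T⊆R v∈T , v∈T))) R≤r))

      separate : 2 ^ b < ∣ U ∣ → Separated
      separate big = loop ∣ U ∣ start big ≤-refl
        where
        start : State Subset.⊥ U 0
        start = record
          { model     = emptyModel
          ; Z         = Subset.⊥
          ; k≤h       = z≤n
          ; S⊆U       = λ x∈ → contradiction x∈ ∉⊥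
          ; R⊆U       = ⊆-refl
          ; bag⊆U     = λ ()
          ; S-R-apart = (λ x x∈ _ → ∉⊥ x∈) , λ (_ , _ , x∈ , _) → ∉⊥ x∈
          ; bag-R     = λ ()
          ; cover     = inj₂ ∘ inj₁
          ; Z-sparse  = ≤-reflexive (trans (cong (l *_) (∣⊥∣≡0 (n G))) (trans (*-zeroʳ l) (sym (∣⊥∣≡0 (n G)))))
          }

-- Powers of two against polynomials, and the cost of bags.

n<2^n : ∀ n → n < 2 ^ n
n<2^n zero    = ≤-refl
n<2^n (suc n) = ≤-trans (+-mono-≤ (≤-trans (s≤s z≤n) (n<2^n n)) (n<2^n n))
  (≤-reflexive (cong (2 ^ n +_) (sym (+-identityʳ (2 ^ n)))))

*-interchange : ∀ a b c d → a * b * (c * d) ≡ a * c * (b * d)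
*-interchange = solve-∀

^-distribʳ-* : ∀ o m n → (m * n) ^ o ≡ m ^ o * n ^ o
^-distribʳ-* zero    m n = refl
^-distribʳ-* (suc o) m n = trans (cong (m * n *_) (^-distribʳ-* o m n)) (*-interchange m n (m ^ o) (n ^ o))

-- Raise `y ≤ d * 2 ^ (y / d)` to the power `d`.
y^d≤d^d*2^y : ∀ d .{{_ : NonZero d}} y → y ^ d ≤ d ^ d * 2 ^ y
y^d≤d^d*2^y d y = begin
  y ^ d                  ≤⟨ ^-monoˡ-≤ d y≤d*2^q ⟩
  (d * 2 ^ q) ^ d        ≡⟨ ^-distribʳ-* d d (2 ^ q) ⟩
  d ^ d * (2 ^ q) ^ d    ≡⟨ cong (d ^ d *_) (^-*-assoc 2 q d) ⟩
  d ^ d * 2 ^ (q * d)    ≤⟨ *-monoʳ-≤ (d ^ d) (^-monoʳ-≤ 2 (m/n*n≤m y d)) ⟩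
  d ^ d * 2 ^ y          ∎
  where
  open ≤-Reasoning
  q = y / d
  y≤d*2^q : y ≤ d * 2 ^ q
  y≤d*2^q = begin
    y              ≡⟨ m≡m%n+[m/n]*n y d ⟩
    y % d + q * d  ≤⟨ +-monoˡ-≤ (q * d) (<⇒≤ (m%n<n y d)) ⟩
    suc q * d      ≤⟨ *-monoˡ-≤ d (n<2^n q) ⟩
    2 ^ q * d      ≡⟨ *-comm (2 ^ q) d ⟩
    d * 2 ^ q      ∎

-- The previous bound with exponent `suc k` leaves a spare factor `y`, which absorbs the constants
-- once `y` is at least `C * suc k ^ suc k`.
eventually-C*y^k≤2^y : ∀ k C → ∃[ e ] (∀ y → e ≤ y → C * y ^ k ≤ 2 ^ y)
eventually-C*y^k≤2^y k C = C * A , λ y large → *-cancelˡ-≤ A {{m^n≢0 (suc k) (suc k)}} (begin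
  A * (C * y ^ k)  ≡⟨ *-assoc A C (y ^ k) ⟨
  A * C * y ^ k    ≡⟨ cong (_* y ^ k) (*-comm A C) ⟩
  C * A * y ^ k    ≤⟨ *-monoˡ-≤ (y ^ k) large ⟩
  y ^ suc k        ≤⟨ y^d≤d^d*2^y (suc k) y ⟩
  A * 2 ^ y        ∎)
  where
  open ≤-Reasoning
  A = suc k ^ suc k

-- Separating sets of size about 2 ^ (i + e) costs a proportion of 1 / (D (i + 1)(i + 2)); the
-- telescoping sum of these is less than 1 / D.
rate : ℕ → ℕ → ℕ
rate D i = 2 * (D * (suc i * suc (suc i)))

-- The bag charge in `Separated` is at most `2 ^ b`, hence below the size of any set that still has
-- to be split at this scale.
BagsCheap : (h D e : ℕ) → Set
BagsCheap h D e = ∀ i → let l = rate D i ; b = i + e in l * (h * suc (h * (2 * suc (suc b * l)))) ≤ 2 ^ b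

-- With `y = b + 2`, `l` is at most `2 * D * y ^ 2` and a bag has at most `7 * suc h * D * y ^ 3`
-- vertices; hence the degree 5 and the constant `56 = 4 * 2 * 7`.
dominated⇒BagsCheap : ∀ h D .{{_ : NonZero D}} {e} → (∀ y → e ≤ y → 56 * (suc h * suc h * (D * D)) * y ^ 5 ≤ 2 ^ y) →
                      BagsCheap h D e
dominated⇒BagsCheap h D {e} dominated i = *-cancelˡ-≤ 4 (begin
    -- The factor 4 makes up for the shift from `2 ^ b` to `2 ^ y`.
    4 * (l * (h * suc (h * (2 * suc (suc b * l)))))
      ≤⟨ *-monoʳ-≤ 4 (*-mono-≤ l≤ (*-mono-≤ (n≤1+n h) bag≤)) ⟩
    4 * (2 * (D * (y * y)) * (c * (7 * (c * (D * (y * (y * y)))))))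
      ≡⟨ collect c D y ⟩
    56 * (c * c * (D * D)) * y ^ 5
      ≤⟨ dominated y (m≤n⇒m≤o+n (suc (suc i)) ≤-refl) ⟩
    2 ^ y
      ≡⟨ *-assoc 2 2 (2 ^ b) ⟨
    4 * 2 ^ b ∎)
  where
    open ≤-Reasoning
    c = suc h
    l = rate D i
    b = i + e
    y = suc (suc b)
    collect : ∀ c D y → 4 * (2 * (D * (y * y)) * (c * (7 * (c * (D * (y * (y * y))))))) ≡
              56 * (c * c * (D * D)) * (y * (y * (y * (y * (y * 1)))))
    collect = solve-∀
    2+i≤y : suc (suc i) ≤ y
    2+i≤y = s≤s (s≤s (m≤m+n i e))
    l≤ : l ≤ 2 * (D * (y * y))
    l≤ = *-monoʳ-≤ 2 (*-monoʳ-≤ D (*-mono-≤ (≤-trans (n≤1+n _) 2+i≤y) 2+i≤y))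
    1≤y : 1 ≤ y
    1≤y = s≤s z≤n
    Dy³ = D * (y * (y * y))
    1≤Dy³ : 1 ≤ Dy³
    1≤Dy³ = *-mono-≤ (>-nonZero⁻¹ D) (*-mono-≤ 1≤y (*-mono-≤ 1≤y 1≤y))
    ball≤ : suc (suc b * l) ≤ 3 * Dy³
    ball≤ = begin
      1 + suc b * l                  ≤⟨ +-mono-≤ 1≤Dy³ (*-mono-≤ (n≤1+n (suc b)) l≤) ⟩
      Dy³ + y * (2 * (D * (y * y)))  ≡⟨ collect′ D y ⟩
      3 * Dy³                        ∎
      where
      collect′ : ∀ D y → D * (y * (y * y)) + y * (2 * (D * (y * y))) ≡ 3 * (D * (y * (y * y)))
      collect′ = solve-∀
    bag≤ : suc (h * (2 * suc (suc b * l))) ≤ 7 * (c * Dy³)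
    bag≤ = begin
      1 + h * (2 * suc (suc b * l))  ≤⟨ +-mono-≤ {1} {c * Dy³} (*-mono-≤ {1} {c} (s≤s z≤n) 1≤Dy³)
                                          (*-mono-≤ (n≤1+n h) (*-monoʳ-≤ 2 ball≤)) ⟩
      c * Dy³ + c * (2 * (3 * Dy³))  ≡⟨ collect′ c Dy³ ⟩
      7 * (c * Dy³)                  ∎
      where
      collect′ : ∀ c z → c * z + c * (2 * (3 * z)) ≡ 7 * (c * z)
      collect′ = solve-∀

-- Opaque because unfolding e would evaluate 6 ^ 6.
opaque
  eventually-BagsCheap : ∀ h D .{{_ : NonZero D}} → ∃[ e ] BagsCheap h D e
  eventually-BagsCheap h D =
    let e , dominated = eventually-C*y^k≤2^y 5 (56 * (suc h * suc h * (D * D)))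
    in e , dominated⇒BagsCheap h D dominated

-- This is `i / (i + 1) + 1 / ((i + 1) * (i + 2)) = (i + 1) / (i + 2)` with denominators cleared;
-- the factor 2 in `rate` absorbs `u + u`.
telescope : ∀ D i {x₀ x u u′} → rate D i * x₀ ≤ u + u → D * suc i * x ≤ i * u′ → u′ ≤ u →
            D * suc (suc i) * (x₀ + x) ≤ suc i * u
telescope D i {x₀} {x} {u} {u′} cost₀ cost u′≤u = *-cancelˡ-≤ (suc i) (begin
  suc i * (D * suc (suc i) * (x₀ + x))
    ≡⟨ lhs D (suc i) (suc (suc i)) x₀ x ⟩
  D * (suc i * suc (suc i)) * x₀ + suc (suc i) * (D * suc i * x)
    ≤⟨ +-mono-≤ halved (*-monoʳ-≤ (suc (suc i)) (≤-trans cost (*-monoʳ-≤ i u′≤u))) ⟩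
  u + suc (suc i) * (i * u)
    ≡⟨ rhs i u ⟩
  suc i * (suc i * u) ∎)
  where
  open ≤-Reasoning
  lhs : ∀ D a b x₀ x → a * (D * b * (x₀ + x)) ≡ D * (a * b) * x₀ + b * (D * a * x)
  lhs = solve-∀
  rhs : ∀ i u → u + suc (suc i) * (i * u) ≡ suc i * (suc i * u)
  rhs = solve-∀
  halved : D * (suc i * suc (suc i)) * x₀ ≤ u
  halved = *-cancelˡ-≤ 2 (begin
    2 * (D * (suc i * suc (suc i)) * x₀) ≡⟨ *-assoc 2 (D * (suc i * suc (suc i))) x₀ ⟨
    rate D i * x₀                        ≤⟨ cost₀ ⟩
    u + u                                ≡⟨ cong (u +_) (+-identityʳ u) ⟨
    2 * u                                ∎)

-- Repeated halving and hyperfiniteness.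

module _ (G : Graph) where

  All-⊆ : ∀ {U U′ : Subset (n G)} {Ps} → U ⊆ U′ → All (_⊆ U) Ps → All (_⊆ U′) Ps
  All-⊆ U⊆U′ []         = []
  All-⊆ U⊆U′ (P⊆ ∷ Ps⊆) = (λ x∈ → U⊆U′ (P⊆ x∈)) ∷ All-⊆ U⊆U′ Ps⊆

  Decomposition-∪ : ∀ {K U₁ U₂ X₁ X₂} → Apart G U₁ U₂ → Decomposition G K U₁ X₁ → Decomposition G K U₂ X₂ →
                    Decomposition G K (U₁ ∪ U₂) (X₁ ∪ X₂)
  Decomposition-∪ {K} {U₁} {U₂} {X₁} {X₂} apart (mkDecomposition Ps small₁ apart₁ within₁ cover₁)
                                      (mkDecomposition Qs small₂ apart₂ within₂ cover₂) =
    mkDecomposition (Ps ++ Qs) (All.++⁺ small₁ small₂)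
      (AllPairs.++⁺ apart₁ apart₂ (All.map {P = _⊆ U₁} (λ P⊆ → All.map {P = _⊆ U₂} (λ Q⊆ → Apart-⊆ G P⊆ Q⊆ apart) within₂) within₁))
      (All.++⁺ (All-⊆ (p⊆p∪q U₂) within₁) (All-⊆ (q⊆p∪q U₁ U₂) within₂))
      (λ x∈ → [ [ inj₁ ∘ p⊆p∪q X₂ , inj₂ ∘ Any.++⁺ˡ ]′ ∘ cover₁
              , [ inj₁ ∘ q⊆p∪q X₁ X₂ , inj₂ ∘ Any.++⁺ʳ Ps ]′ ∘ cover₂ ]′ (x∈p∪q⁻ U₁ U₂ x∈))

  Decomposable : (K a c : ℕ) → Subset (n G) → Set
  Decomposable K a c U = ∃[ X ] (Decomposition G K U X × a * ∣ X ∣ ≤ c * ∣ U ∣)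

  singlePart : ∀ {K U} → ∣ U ∣ ≤ K → Decomposition G K U Subset.⊥
  singlePart {U = U} small = mkDecomposition (U ∷ []) (small ∷ []) ([] ∷ []) (⊆-refl ∷ []) (inj₂ ∘ here)

  Apart-⋃ : ∀ {P} Ps → All (Apart G P) Ps → Apart G P (⋃ Ps)
  Apart-⋃ []       []               = Apart-⊥ G
  Apart-⋃ (Q ∷ Qs) (apart ∷ aparts) = Apart-sym (Apart-∪ˡ G (Apart-sym apart) (Apart-sym (Apart-⋃ Qs aparts)))
    where
    Apart-sym : ∀ {p q} → Apart G p q → Apart G q p
    Apart-sym (disj , ¬touch) = (λ x x∈q x∈p → disj x x∈p x∈q) , ¬touch ∘ Touch-sym G

  -- Mutually apart sets can be decomposed separately, and by disjointness the costs add up against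
  -- the size of the union.
  ⋃-decomposable : ∀ K a c Ps → AllPairs (Apart G) Ps → All (Decomposable K a c) Ps → Decomposable K a c (⋃ Ps)
  ⋃-decomposable K a c [] [] [] = Subset.⊥ ,
    mkDecomposition [] [] [] [] (λ x∈ → contradiction x∈ ∉⊥) ,
    ≤-trans (≤-reflexive (trans (cong (a *_) (∣⊥∣≡0 (n G))) (*-zeroʳ a))) z≤n
  ⋃-decomposable K a c (P ∷ Ps) (apart ∷ aparts) ((X , dec , cost) ∷ decs) with ⋃-decomposable K a c Ps aparts decs
  ... | Y , dec′ , cost′ = X ∪ Y , Decomposition-∪ (Apart-⋃ Ps apart) dec dec′ , (begin
    a * ∣ X ∪ Y ∣             ≤⟨ *-monoʳ-≤ a (∣p∪q∣≤∣p∣+∣q∣ X Y) ⟩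
    a * (∣ X ∣ + ∣ Y ∣)        ≡⟨ *-distribˡ-+ a ∣ X ∣ ∣ Y ∣ ⟩
    a * ∣ X ∣ + a * ∣ Y ∣      ≤⟨ +-mono-≤ cost cost′ ⟩
    c * ∣ P ∣ + c * ∣ ⋃ Ps ∣   ≡⟨ *-distribˡ-+ c ∣ P ∣ ∣ ⋃ Ps ∣ ⟨
    c * (∣ P ∣ + ∣ ⋃ Ps ∣)     ≤⟨ *-monoʳ-≤ c (∣p∣+∣q∣≤∣p∪q∣ P (⋃ Ps) (proj₁ (Apart-⋃ Ps apart))) ⟩
    c * ∣ P ∪ ⋃ Ps ∣          ∎)
    where open ≤-Reasoning

  ⋃-lub : ∀ {U : Subset (n G)} {Ps} → All (_⊆ U) Ps → ⋃ Ps ⊆ U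
  ⋃-lub []        x∈ = contradiction x∈ ∉⊥
  ⋃-lub (P⊆ ∷ Ps⊆) x∈ = ∪-lub P⊆ (⋃-lub Ps⊆) x∈

  ∈⋃ : ∀ {x} {Ps : List (Subset (n G))} → Any (x ∈_) Ps → x ∈ ⋃ Ps
  ∈⋃ (here x∈)          = p⊆p∪q _ x∈
  ∈⋃ {Ps = P ∷ _} (there x∈) = q⊆p∪q P _ (∈⋃ x∈)

  -- What `X` misses lies in the union of the old parts, and the new parts cover that union up to
  -- `Y`.
  refine : ∀ {K K′ U X Y} (dec : Decomposition G K U X) → Decomposition G K′ (⋃ (Decomposition.parts dec)) Y →
           Decomposition G K′ U (X ∪ Y)
  refine {X = X} {Y} dec (mkDecomposition Qs small apart within cover) = mkDecomposition Qs small apart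
    (All-⊆ (⋃-lub parts-within) within)
    (λ x∈ → [ inj₁ ∘ p⊆p∪q Y , map₁ (q⊆p∪q X Y) ∘ cover ∘ ∈⋃ ]′ (parts-cover x∈))
    where open Decomposition dec

  module _ (H : Graph) (H⋠G : MinorFree H G) (D : ℕ) .{{_ : NonZero D}}
           (e : ℕ) (cheap : BagsCheap (n H) D e) where

    -- Induction on the scale: a set above `2 ^ (i + e)` is separated into parts below it, to which
    -- the induction hypothesis applies. At scale 0 the set is itself a small part.
    decompose : ∀ i U → ∣ U ∣ ≤ 2 ^ (i + e) →
                Decomposable (2 ^ e) (D * suc i) i U
    decompose zero U small = Subset.⊥ , singlePart small ,
      ≤-reflexive (trans (cong (D * 1 *_) (∣⊥∣≡0 (n G))) (*-zeroʳ (D * 1)))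
    decompose (suc i) U small with ∣ U ∣ ≤? 2 ^ (i + e)
    ... | yes smaller with decompose i U smaller
    -- Nothing is deleted at this scale, so `x₀ = 0`.
    ...   | X , dec , cost = X , dec , telescope D i (≤-trans (≤-reflexive (*-zeroʳ (rate D i))) z≤n) cost ≤-refl
    decompose (suc i) U small | no big
      with Separator.separate G H H⋠G U (i + e) (rate D i) {{m*n≢0 2 _ {{_}} {{m*n≢0 D _}}}} small (≰⇒> big)
    ... | X₀ , dec₀ , cost₀ with ⋃-decomposable _ (D * suc i) i _ (Decomposition.parts-apart dec₀)
                                   (All.map (λ {P} → decompose i P) (Decomposition.parts-small dec₀))
    ...   | X , dec , cost = X₀ ∪ X , refine dec₀ dec , ≤-trans
      (*-monoʳ-≤ (D * suc (suc i)) (∣p∪q∣≤∣p∣+∣q∣ X₀ X))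
      -- Since `cheap` puts the bag charge below `∣ U ∣`, both charges together are at most
      -- `∣ U ∣ + ∣ U ∣`.
      (telescope D i (≤-trans cost₀ (+-monoʳ-≤ ∣ U ∣ (≤-trans (cheap i) (<⇒≤ (≰⇒> big)))))
        cost (p⊆q⇒∣p∣≤∣q∣ (⋃-lub (Decomposition.parts-within dec₀))))

-- Scale `n G` suffices because `n G < 2 ^ n G`, and the proportion `i / (D * (i + 1))` stays below
-- `1 / D` at every scale `i`; the part size `2 ^ e` depends on `H` and `D` alone.
hyperfinite : ∀ H D .{{_ : NonZero D}} → ∃[ K ] (∀ G → MinorFree H G →
              ∃[ X ] (Decomposition G K ⊤ X × D * ∣ X ∣ ≤ n G))
hyperfinite H D with eventually-BagsCheap (n H) D
... | e , cheap = 2 ^ e , λ G H⋠G →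
  let X , dec , cost = decompose G H H⋠G D e cheap (n G) ⊤ (≤-trans (≤-reflexive (∣⊤∣≡n (n G)))
                         (≤-trans (<⇒≤ (n<2^n (n G))) (^-monoʳ-≤ 2 (m≤m+n (n G) e))))
  in X , dec , *-cancelˡ-≤ (suc (n G)) (begin
    suc (n G) * (D * ∣ X ∣)   ≡⟨ *-assoc (suc (n G)) D ∣ X ∣ ⟨
    suc (n G) * D * ∣ X ∣     ≡⟨ cong (_* ∣ X ∣) (*-comm (suc (n G)) D) ⟩
    D * suc (n G) * ∣ X ∣     ≤⟨ cost ⟩
    n G * ∣ ⊤ {n G} ∣         ≡⟨ cong (n G *_) (∣⊤∣≡n (n G)) ⟩
    n G * n G                 ≤⟨ *-monoˡ-≤ (n G) (n≤1+n (n G)) ⟩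
    suc (n G) * n G           ∎)
  where open ≤-Reasoning

-- Counting with disjoint families and with covers.

AllPairs-lookup : ∀ {A : Set a} {R : Rel A ℓ} → Symmetric R → ∀ {xs} → AllPairs R xs →
                  ∀ i j → i ≢ j → R (List.lookup xs i) (List.lookup xs j)
AllPairs-lookup R-sym (_  ∷ _)  zero    zero    0≢0 = contradiction refl 0≢0
AllPairs-lookup R-sym (rs ∷ _)  zero    (suc j) _   = All.lookup rs (∈-lookup j)
AllPairs-lookup R-sym (rs ∷ _)  (suc i) zero    _   = R-sym (All.lookup rs (∈-lookup i))
AllPairs-lookup R-sym (_  ∷ ps) (suc i) (suc j) i≢j = AllPairs-lookup R-sym ps i j (i≢j ∘ cong suc)

-- Removing `S zero` from `A` loses at least one vertex and, by disjointness, leaves every other set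
-- hit.
hitting-size : ∀ {k} (S : Fin k → Subset m) (A : Subset m) → (∀ i j → i ≢ j → Disjoint (S i) (S j)) →
               (∀ i → Nonempty (A ∩ S i)) → k ≤ ∣ A ∣
hitting-size {k = zero}  S A disj hit = z≤n
hitting-size {k = suc k} S A disj hit =
  ≤-trans (s≤s (hitting-size (S ∘ suc) (A ─ S zero) (λ i j i≢j → disj _ _ (i≢j ∘ suc-injective)) hit′))
    (p∩q≢∅⇒∣p─q∣<∣p∣ A (S zero) (hit zero))
  where
  hit′ : ∀ i → Nonempty ((A ─ S zero) ∩ S (suc i))
  hit′ i with hit (suc i)
  ... | x , x∈ with x∈p∩q⁻ A (S (suc i)) x∈
  ...   | x∈A , x∈S = x , x∈p∩q⁺ (x∈p∧x∉q⇒x∈p─q x∈A (λ x∈0 → disj zero (suc i) (λ ()) x x∈0 x∈S) , x∈S)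

-- Only non-empty pieces are counted, because these are the ones that become islands.
pieces-size : ∀ K Ps (J : Subset m) → (∀ {x} → x ∈ J → Any (x ∈_) Ps) → All (λ P → ∣ P ∣ ≤ K) Ps →
              ∣ J ∣ ≤ K * length (filter nonempty? Ps)
pieces-size {m} K [] J cover small with nonempty? J
... | yes (_ , x∈) with () ← cover x∈
... | no  empty    = ≤-trans (≤-reflexive (trans (cong ∣_∣ (Empty-unique empty)) (∣⊥∣≡0 m))) z≤n
pieces-size K (P ∷ Ps) J cover (P≤K ∷ small) with nonempty? P
... | no empty = pieces-size K Ps J (tail ∘ cover) small
  where
  tail : ∀ {x} → Any (x ∈_) (P ∷ Ps) → Any (x ∈_) Ps
  tail (here x∈P) = contradiction (_ , x∈P) empty
  tail (there x∈) = x∈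
... | yes _ = begin
  ∣ J ∣                                      ≤⟨ p⊆q⇒∣p∣≤∣q∣ J⊆ ⟩
  ∣ P ∪ (J ─ P) ∣                            ≤⟨ ∣p∪q∣≤∣p∣+∣q∣ P (J ─ P) ⟩
  ∣ P ∣ + ∣ J ─ P ∣                           ≤⟨ +-mono-≤ P≤K (pieces-size K Ps (J ─ P) cover′ small) ⟩
  K + K * length (filter nonempty? Ps)       ≡⟨ *-suc K _ ⟨
  K * suc (length (filter nonempty? Ps))     ∎
  where
  open ≤-Reasoning
  J⊆ : J ⊆ P ∪ (J ─ P)
  J⊆ {x} x∈J with x ∈? P
  ... | yes x∈P = p⊆p∪q _ x∈P
  ... | no  x∉P = q⊆p∪q P _ (x∈p∧x∉q⇒x∈p─q x∈J x∉P)
  cover′ : ∀ {x} → x ∈ J ─ P → Any (x ∈_) Ps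
  cover′ x∈ with cover (p─q⊆p J P x∈)
  ... | here x∈P  = contradiction x∈P (x∈p─q⇒x∉q J P x∈)
  ... | there x∈Q = x∈Q

-- Percolation and islands in one graph.

module Percolation (t : ℕ) (G : Graph) where

  ∧-true⁻ : ∀ {x y} → x ∧ y ≡ true → x ≡ true × y ≡ true
  ∧-true⁻ {true} {true} refl = refl , refl

  nbrsIn-mono : ∀ {A B} v → (∀ {u} → Adj G v u → u ∈ A → u ∈ B) → nbrsIn G A v ≤ nbrsIn G B v
  nbrsIn-mono v A⇒B = p⊆q⇒∣p∣≤∣q∣ (tabulate-⊆ λ u au → let vu , uA = ∧-true⁻ au in
    cong₂ _∧_ vu ([]=⇒lookup (A⇒B vu (lookup⇒[]= u _ uA))))

  nbrsIn≤nbrsOut : ∀ {A S} v → Disjoint A S → nbrsIn G A v ≤ nbrsOut G S v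
  nbrsIn≤nbrsOut {A} {S} v disj = p⊆q⇒∣p∣≤∣q∣ (tabulate-⊆ λ u au → let vu , uA = ∧-true⁻ au in
    cong₂ _∧_ vu (u∉S u (disj u (lookup⇒[]= u A uA))))
    where
    u∉S : ∀ u → u ∉ S → not (lookup S u) ≡ true
    u∉S u u∉ with lookup S u in eq
    ... | true  = contradiction (lookup⇒[]= u S eq) u∉
    ... | false = refl

  nbrsOut≤nbrsIn : ∀ {C S} v → (∀ {u} → Adj G v u → u ∉ S → u ∈ C) → nbrsOut G S v ≤ nbrsIn G C v
  nbrsOut≤nbrsIn {C} {S} v out⇒C = p⊆q⇒∣p∣≤∣q∣ (tabulate-⊆ λ u au → let vu , uS = ∧-true⁻ au in
    cong₂ _∧_ vu ([]=⇒lookup (out⇒C vu (u∉S u uS))))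
    where
    u∉S : ∀ u → not (lookup S u) ≡ true → u ∉ S
    u∉S u eq u∈ with () ← trans (sym eq) (cong not ([]=⇒lookup u∈))

  percolate : ℕ → Subset (n G) → Subset (n G)
  percolate = iter (percStep t G)

  percStep⁻ : ∀ A {v} → v ∈ percStep t G A → v ∈ A ⊎ t ≤ nbrsIn G A v
  percStep⁻ A {v} v∈ with lookup A v in eq | ∈tabulate⁻ _ v∈
  ... | true  | _     = inj₁ (lookup⇒[]= v A eq)
  ... | false | t≤ᵇ   = inj₂ (≤ᵇ⇒≤ t _ (from T-≡ t≤ᵇ))

  percStep⁺ : ∀ A {v} → v ∈ A ⊎ t ≤ nbrsIn G A v → v ∈ percStep t G A
  percStep⁺ A {v} (inj₁ v∈) = ∈tabulate⁺ _ (cong (_∨ (t ≤ᵇ nbrsIn G A v)) ([]=⇒lookup v∈))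
  percStep⁺ A {v} (inj₂ t≤) = ∈tabulate⁺ _ (trans (cong (lookup A v ∨_) (to T-≡ (≤⇒≤ᵇ t≤))) (∨-zeroʳ (lookup A v)))

  percStep-mono : ∀ {A B} → A ⊆ B → percStep t G A ⊆ percStep t G B
  percStep-mono {A} {B} A⊆B {v} v∈ with percStep⁻ A v∈
  ... | inj₁ v∈A = percStep⁺ B (inj₁ (A⊆B v∈A))
  ... | inj₂ t≤  = percStep⁺ B (inj₂ (≤-trans t≤ (nbrsIn-mono {A} {B} v (λ _ u∈ → A⊆B u∈))))

  percolate-mono : ∀ k {A B} → A ⊆ B → percolate k A ⊆ percolate k B
  percolate-mono zero    A⊆B = A⊆B
  percolate-mono (suc k) A⊆B = percStep-mono (percolate-mono k A⊆B)

  percolate-⊇ : ∀ k A → A ⊆ percolate k A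
  percolate-⊇ zero    A x∈ = x∈
  percolate-⊇ (suc k) A x∈ = percStep⁺ (percolate k A) (inj₁ (percolate-⊇ k A x∈))

  percolate-suc : ∀ k A → percolate k (percStep t G A) ≡ percolate (suc k) A
  percolate-suc zero    A = refl
  percolate-suc (suc k) A = cong (percStep t G) (percolate-suc k A)

  Stationary : Subset (n G) → Set
  Stationary C = ∀ v → v ∉ C → nbrsIn G C v < t

  -- The fuel `r` bounds the number of inactive vertices, and a round from a set that is not
  -- stationary activates a new one.
  stabilise : ∀ r A → n G ≤ r + ∣ A ∣ → ∃[ k ] Stationary (percolate k A)
  stabilise r A n≤ with any? (λ v → ¬? (v ∈? A) ×-dec t ≤? nbrsIn G A v)
  ... | no  none = 0 , λ v v∉ → ≰⇒> (λ t≤ → none (v , v∉ , t≤))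
  stabilise zero A n≤ | yes (v , v∉ , _) = contradiction
    (subst (v ∈_) (sym (∣p∣≡n⇒p≡⊤ (≤-antisym (∣p∣≤n A) n≤))) ∈⊤) v∉
  stabilise (suc r) A n≤ | yes (v , v∉ , t≤) =
    let k , stable = stabilise r (percStep t G A) (≤-trans n≤
          (≤-trans (≤-reflexive (sym (+-suc r ∣ A ∣))) (+-monoʳ-≤ r
            (p⊂q⇒∣p∣<∣q∣ ((λ x∈ → percStep⁺ A (inj₁ x∈)) , v , percStep⁺ A (inj₂ t≤) , v∉)))))
    in suc k , subst Stationary (percolate-suc k A) stable

  -- While `S` is inactive, the active neighbours of a vertex of `S` all lie outside `S`, so there
  -- are fewer than `t` of them.
  island-blocks : ∀ {S A} → IsIsland t G S → Disjoint A S → ∀ k → Disjoint (percolate k A) S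
  island-blocks island disj zero = disj
  island-blocks {S} {A} island disj (suc k) v v∈ v∈S with percStep⁻ (percolate k A) v∈
  ... | inj₁ v∈A = island-blocks island disj k v v∈A v∈S
  ... | inj₂ t≤  = <⇒≱ (proj₂ island v v∈S) (≤-trans t≤ (nbrsIn≤nbrsOut {S = S} v (island-blocks island disj k)))

  percolating-hits-island : ∀ {S A} → IsIsland t G S → Percolates t G A → Nonempty (A ∩ S)
  percolating-hits-island {S} {A} island@((v , v∈S) , _) (k , full) with nonempty? (A ∩ S)
  ... | yes hit = hit
  ... | no miss = contradiction v∈S
    (island-blocks island (λ x x∈A x∈S → miss (x , x∈p∩q⁺ (x∈A , x∈S))) k v (subst (v ∈_) (sym full) ∈⊤))

  -- Percolation from the deleted set of a decomposition.

  module _ {K X} (dec : Decomposition G K ⊤ X) where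
    open Decomposition dec

    closure : ∃[ k ] Stationary (percolate k X)
    closure = stabilise (n G) X (m≤m+n (n G) ∣ X ∣)

    active inactive : Subset (n G)
    active   = percolate (proj₁ closure) X
    inactive = ∁ active

    islands : List (Subset (n G))
    islands = filter nonempty? (map (_∩ inactive) parts)

    inactive-part : ∀ {x} → x ∈ inactive → Any (x ∈_) parts
    inactive-part x∈ with parts-cover ∈⊤
    ... | inj₁ x∈X = contradiction (percolate-⊇ (proj₁ closure) X x∈X) (x∈∁p⇒x∉p x∈)
    ... | inj₂ x∈P = x∈P

    islands-bound : ∣ inactive ∣ ≤ K * length islands
    islands-bound = pieces-size K _ inactive
      (λ x∈ → Any.map⁺ (Any.map (λ x∈P → x∈p∩q⁺ (x∈P , x∈)) (inactive-part x∈)))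
      (All.map⁺ (All.map (λ {P} small → ≤-trans (∣p∩q∣≤∣p∣ P inactive) small) parts-small))

    islands-disjoint : AllPairs Disjoint islands
    islands-disjoint = AllPairs.filter⁺ nonempty? (AllPairs.map⁺ (AllPairs.map
      (λ {P} {Q} apart x x∈P x∈Q → proj₁ apart x (p∩q⊆p P inactive x∈P) (p∩q⊆p Q inactive x∈Q)) parts-apart))

    -- Different parts do not touch, so no edge leads from one to another; `All` lets the claim be
    -- looked up at a given part.
    part-neighbours : ∀ {Ps} → AllPairs (Apart G) Ps → ∀ {v u} → Adj G v u → Any (u ∈_) Ps →
                      All (λ P → v ∈ P → u ∈ P) Ps
    part-neighbours (apart ∷ _) vu (here u∈P) = (λ _ → u∈P) ∷ All.map
      (λ (_ , ¬touch) v∈Q → contradiction (_ , _ , u∈P , v∈Q , Adj-sym G vu) ¬touch) apart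
    part-neighbours (apart ∷ aparts) {v} {u} vu (there u∈) =
      (λ v∈P → contradiction v∈P (far apart u∈)) ∷ part-neighbours aparts vu u∈
      where
      far : ∀ {P Qs} → All (Apart G P) Qs → Any (u ∈_) Qs → v ∉ P
      far ((_ , ¬touch) ∷ _) (here u∈Q)  v∈P = ¬touch (_ , _ , v∈P , u∈Q , vu)
      far (_ ∷ aparts)       (there u∈Q) v∈P = far aparts u∈Q v∈P

    -- An inactive neighbour of `v` is not in `X`, so it lies in some part, necessarily that of `v`.
    -- The neighbours outside the island are therefore active, and stationarity leaves fewer than
    -- `t` of them.
    islands-are-islands : All (IsIsland t G) islands
    islands-are-islands = All.map (λ (ne , few) → ne , few)
      (All.zip (All.all-filter nonempty? (map (_∩ inactive) parts) ,
                All.filter⁺ nonempty? (All.map⁺ (All.tabulate few-outside))))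
      where
      few-outside : ∀ {P} → P List.∈ parts →
                    ∀ v → v ∈ P ∩ inactive → nbrsOut G (P ∩ inactive) v < t
      few-outside {P} P∈ v v∈ = ≤-<-trans
        (nbrsOut≤nbrsIn {active} {P ∩ inactive} v outside-active)
        (proj₂ closure v (x∈∁p⇒x∉p (p∩q⊆q P inactive v∈)))
        where
        outside-active : ∀ {u} → Adj G v u → u ∉ P ∩ inactive → u ∈ active
        outside-active {u} vu u∉ with u ∈? active
        ... | yes u∈ = u∈
        ... | no u∉active = contradiction
          (x∈p∩q⁺ (All.lookup (part-neighbours parts-apart vu (inactive-part (x∉p⇒x∈∁p u∉active))) P∈ (p∩q⊆p P inactive v∈)
                  , x∉p⇒x∈∁p u∉active)) u∉

    -- By monotonicity, whatever `X` activates is activated again; the rest is active from the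
    -- start.
    percolates : Percolates t G (X ∪ inactive)
    percolates = proj₁ closure , ⊤-⊇ full
      where
      full : ∀ x → x ∈ percolate (proj₁ closure) (X ∪ inactive)
      full x with x ∈? active
      ... | yes x∈ = percolate-mono (proj₁ closure) (p⊆p∪q inactive) x∈
      ... | no  x∉ = percolate-⊇ (proj₁ closure) _ (q⊆p∪q X inactive (x∉p⇒x∈∁p x∉))

-- Rational inequalities with denominators cleared.

toℚᵘ-/ : ∀ p d → toℚᵘ (pos p /ℚ suc d) ℚᵘ.≃ mkℚᵘ (pos p) d
toℚᵘ-/ p d = ℚ.toℚᵘ-fromℚᵘ (mkℚᵘ (pos p) d)

toℚᵘ-scaled : ∀ p d k → toℚᵘ ((pos p /ℚ suc d) *ℚ ℕ→ℚ k) ℚᵘ.≃ mkℚᵘ (pos p) d ℚᵘ.* mkℚᵘ (pos k) 0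
toℚᵘ-scaled p d k = ℚᵘ.≃-trans (ℚ.toℚᵘ-homo-* (pos p /ℚ suc d) (ℕ→ℚ k)) (ℚᵘ.*-cong (toℚᵘ-/ p d) (toℚᵘ-/ k 0))

module _ (p d k a : ℕ) where

  private
    scaled : (pos p ℤ.* pos k) ℤ.* pos 1 ≡ pos (p * k)
    scaled = trans (ℤ.*-identityʳ _) (sym (ℤ.pos-* p k))

    bound : pos a ℤ.* pos (suc (d * 1)) ≡ pos (suc d * a)
    bound = trans (sym (ℤ.pos-* a _)) (cong pos (trans (*-comm a _) (cong (λ x → suc x * a) (*-identityʳ d))))

  ≤-scaled⇔ : ℕ→ℚ a ≤ℚ (pos p /ℚ suc d) *ℚ ℕ→ℚ k ⇔ suc d * a ≤ p * k
  ≤-scaled⇔ = mk⇔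
    (λ le → ℤ.drop‿+≤+ (subst₂ ℤ._≤_ bound scaled (ℚᵘ.drop-*≤* (ℚᵘ.≤-respˡ-≃ (toℚᵘ-/ a 0)
      (ℚᵘ.≤-respʳ-≃ (toℚᵘ-scaled p d k) (ℚ.toℚᵘ-mono-≤ le))))))
    (λ le → ℚ.toℚᵘ-cancel-≤ (ℚᵘ.≤-respˡ-≃ (ℚᵘ.≃-sym (toℚᵘ-/ a 0)) (ℚᵘ.≤-respʳ-≃ (ℚᵘ.≃-sym (toℚᵘ-scaled p d k))
      (ℚᵘ.*≤* (subst₂ ℤ._≤_ (sym bound) (sym scaled) (+≤+ le))))))

  scaled-≤⇔ : (pos p /ℚ suc d) *ℚ ℕ→ℚ k ≤ℚ ℕ→ℚ a ⇔ p * k ≤ suc d * a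
  scaled-≤⇔ = mk⇔
    (λ le → ℤ.drop‿+≤+ (subst₂ ℤ._≤_ scaled bound (ℚᵘ.drop-*≤* (ℚᵘ.≤-respʳ-≃ (toℚᵘ-/ a 0)
      (ℚᵘ.≤-respˡ-≃ (toℚᵘ-scaled p d k) (ℚ.toℚᵘ-mono-≤ le))))))
    (λ le → ℚ.toℚᵘ-cancel-≤ (ℚᵘ.≤-respʳ-≃ (ℚᵘ.≃-sym (toℚᵘ-/ a 0)) (ℚᵘ.≤-respˡ-≃ (ℚᵘ.≃-sym (toℚᵘ-scaled p d k))
      (ℚᵘ.*≤* (subst₂ ℤ._≤_ (sym scaled) (sym bound) (+≤+ le))))))

0<1/ : ∀ d → 0ℚ <ℚ (pos 1 /ℚ suc d)
0<1/ d = ℚ.positive⁻¹ _ {{ℚ.normalize-pos 1 (suc d)}}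

positive-fraction : ∀ {ε} → 0ℚ <ℚ ε → ∃[ p ] ∃[ d ] ε ≡ (pos (suc p) /ℚ suc d)
positive-fraction {ε@(mkℚ (pos (suc p)) d _)} _ = p , d , sym (ℚ.fromℚᵘ-toℚᵘ ε)
positive-fraction {mkℚ (pos zero) d _}    (ℚ.*<* lt) = contradiction lt (ℤ.<-irrefl refl)
positive-fraction {mkℚ ℤ.-[1+ _ ] d _} (ℚ.*<* ())

-- Equivalence of the two properties for a fixed `t`.

module _ (t : ℕ) where

  -- A percolating `A` hits all `k` disjoint islands, so `n G ≤ D * ∣ A ∣`, whereas smallness gives
  -- `2 * D * ∣ A ∣ ≤ n G`.
  islands⇒resistant : ∀ D G → 0 < n G → (∃[ k ] Σ (Fin k → Subset (n G)) λ S →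
                        n G ≤ D * k × (∀ i → IsIsland t G (S i)) × (∀ i j → i ≢ j → Disjoint (S i) (S j))) →
                      ∀ A → suc (2 * D) * ∣ A ∣ ≤ n G → ¬ Percolates t G A
  islands⇒resistant D G 0<n (k , S , n≤ , isl , disj) A small perc = <⇒≱ 0<n (+-cancelˡ-≤ (n G) (n G) 0 (begin
    n G + n G              ≤⟨ +-mono-≤ n≤D∣A∣ n≤D∣A∣ ⟩
    D * ∣ A ∣ + D * ∣ A ∣    ≡⟨ *-distribʳ-+ ∣ A ∣ D D ⟨
    (D + D) * ∣ A ∣         ≡⟨ cong (λ x → (D + x) * ∣ A ∣) (+-identityʳ D) ⟨
    2 * D * ∣ A ∣           ≤⟨ ≤-trans (m≤n+m _ ∣ A ∣) small ⟩
    n G                    ≡⟨ +-identityʳ (n G) ⟨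
    n G + 0                ∎))
    where
    open ≤-Reasoning
    n≤D∣A∣ : n G ≤ D * ∣ A ∣
    n≤D∣A∣ = ≤-trans n≤ (*-monoʳ-≤ D (hitting-size S A disj (λ i → Percolation.percolating-hits-island t G (isl i) perc)))

  PcolProp⇒PercProp : ∀ 𝒢 → PcolProp 𝒢 t → PercProp 𝒢 t
  PcolProp⇒PercProp 𝒢 (ε , 0<ε , many) with positive-fraction 0<ε
  ... | p , d , refl = (pos 1 /ℚ suc (2 * suc d)) , 0<1/ (2 * suc d) , λ G G∈ 0<n A small →
    let k , S , ε≤ , isl , disj = many G G∈ in
    islands⇒resistant (suc d) G 0<n
      -- Replaces `ε` by the smaller `1 / suc d`, since `n G ≤ suc p * n G`.
      (k , S , ≤-trans (m≤m+n (n G) (p * n G)) (to (scaled-≤⇔ (suc p) d (n G) k) ε≤) , isl , disj)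
      A (≤-trans (to (≤-scaled⇔ 1 (2 * suc d) (n G) ∣ A ∣) small) (≤-reflexive (*-identityˡ (n G))))

  -- If there are too few islands, `X` and the inactive set each have at most `n G / (2 * D)`
  -- vertices; their union percolates and is too small to do so.
  resistant⇒islands : ∀ D .{{_ : NonZero D}} G {K X} (dec : Decomposition G K ⊤ X) → 2 * D * ∣ X ∣ ≤ n G →
                      (0 < n G → ∀ A → D * ∣ A ∣ ≤ n G → ¬ Percolates t G A) →
                      n G ≤ 2 * D * K * length (Percolation.islands t G dec)
  resistant⇒islands D G {K} {X} dec X-small resistant with n G ≤? 2 * D * K * length (Percolation.islands t G dec)
  ... | yes many = many
  -- The failure of the bound also yields `0 < n G`.
  ... | no few   = contradiction (percolates dec) (resistant (≤-trans (s≤s z≤n) (≰⇒> few)) A A-small)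
    where
    open Percolation t G
    A = X ∪ inactive dec
    open ≤-Reasoning
    A-small : D * ∣ A ∣ ≤ n G
    A-small = *-cancelˡ-≤ 2 (begin
      2 * (D * ∣ A ∣)                           ≡⟨ *-assoc 2 D ∣ A ∣ ⟨
      2 * D * ∣ A ∣                             ≤⟨ *-monoʳ-≤ (2 * D) (∣p∪q∣≤∣p∣+∣q∣ X (inactive dec)) ⟩
      2 * D * (∣ X ∣ + ∣ inactive dec ∣)         ≡⟨ *-distribˡ-+ (2 * D) ∣ X ∣ _ ⟩
      2 * D * ∣ X ∣ + 2 * D * ∣ inactive dec ∣   ≤⟨ +-mono-≤ X-small (*-monoʳ-≤ (2 * D) (islands-bound dec)) ⟩
      n G + 2 * D * (K * length (islands dec))  ≡⟨ cong (n G +_) (*-assoc (2 * D) K _) ⟨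
      n G + 2 * D * K * length (islands dec)    ≤⟨ +-monoʳ-≤ (n G) (<⇒≤ (≰⇒> few)) ⟩
      n G + n G                                 ≡⟨ cong (n G +_) (+-identityʳ (n G)) ⟨
      2 * n G                                   ∎)

  PercProp⇒PcolProp : ∀ 𝒢 H → (∀ G → 𝒢 G → MinorFree H G) → PercProp 𝒢 t → PcolProp 𝒢 t
  PercProp⇒PcolProp 𝒢 H free (ε , 0<ε , resistant) with positive-fraction 0<ε
  -- The factor 2 reserves half of the resistance budget for the inactive vertices.
  ... | p , d , refl with hyperfinite H (2 * suc d)
  -- The denominator is `suc E` because nothing is known here about `K` being nonzero.
  ...   | K , decompose = (pos 1 /ℚ suc E) , 0<1/ E , many
    where
    D = suc d
    E = 2 * D * K
    many : ∀ G → 𝒢 G → HasManyIslands (pos 1 /ℚ suc E) t G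
    many G G∈ with decompose G (free G G∈)
    ... | X , dec , cost = length isl , List.lookup isl ,
      from (scaled-≤⇔ 1 E (n G) (length isl)) (begin
        1 * n G                 ≡⟨ *-identityˡ (n G) ⟩
        n G                     ≤⟨ resistant⇒islands D G dec cost resist ⟩
        E * length isl          ≤⟨ m≤n+m _ (length isl) ⟩
        suc E * length isl      ∎) ,
      (λ i → All.lookup (Percolation.islands-are-islands t G dec) (∈-lookup i)) ,
      AllPairs-lookup (λ disj x x∈Q x∈P → disj x x∈P x∈Q) (Percolation.islands-disjoint t G dec)
      where
      open ≤-Reasoning
      isl = Percolation.islands t G dec
      resist : 0 < n G → ∀ A → D * ∣ A ∣ ≤ n G → ¬ Percolates t G A
      resist 0<n A small = resistant G G∈ 0<n A
        (from (≤-scaled⇔ (suc p) d (n G) ∣ A ∣) (≤-trans small (m≤m+n (n G) (p * n G))))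

IsMinimum-cong : ∀ {P Q : ℕ → Set} → (∀ t → P t → Q t) → (∀ t → Q t → P t) → ∀ m → IsMinimum P m → IsMinimum Q m
IsMinimum-cong P⇒Q Q⇒P (just t) (Pt , least) = P⇒Q t Pt , λ s s<t Qs → least s s<t (Q⇒P s Qs)
IsMinimum-cong P⇒Q Q⇒P nothing  none         = λ t Qt → none t (Q⇒P t Qt)

theorem16 : (𝒢 : GraphClass) → ClosedUnderSubgraphs 𝒢 →
    (∃[ H ] (∀ G → 𝒢 G → MinorFree H G)) →
    ∀ (m : Maybe ℕ) → (PcolNumber 𝒢 m → PercThreshold 𝒢 m) × (PercThreshold 𝒢 m → PcolNumber 𝒢 m)
theorem16 𝒢 _ (H , free) m = IsMinimum-cong ⇒ ⇐ m , IsMinimum-cong ⇐ ⇒ m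
  where
  ⇒ : ∀ t → PcolProp 𝒢 t → PercProp 𝒢 t
  ⇒ t = PcolProp⇒PercProp t 𝒢
  ⇐ : ∀ t → PercProp 𝒢 t → PcolProp 𝒢 t
  ⇐ t = PercProp⇒PcolProp t 𝒢 H free
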